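{- There exists an $O(k5^k)$-approximation algorithm for the unweighted $(k,m)$-CDS problem in unit disk graphs if $m\ge k$. That is, there are a universal constant $C$ and a polynomial-time algorithm which, given a unit disk graph $G=(V,E)$ and positive integers $k,m$ with $m\ge k$ such that $G$ has a $(k,m)$-CDS, outputs a $(k,m)$-CDS of $G$ of cardinality at most $C\,k\,5^k\cdot \mathrm{OPT}$, where $\mathrm{OPT}$ is the minimum cardinality of a $(k,m)$-CDS of $G$.
   Context: Graphs are finite, undirected and simple. In a unit disk graph, each node is placed at a point of the Euclidean plane, and two nodes are joined by an edge if and only if their distance is at most a unit length. For $S\subseteq V$, $G[S]$ is the subgraph induced by $S$. A graph is $k$-connected if it is connected even when any $k-1$ or fewer nodes are removed; by convention a complete graph on at most $k$ nodes is $k$-connected. A set $S\subseteq V$ is $k$-connected if $G[S]$ is $k$-connected, and $m$-dominating if every node of $V\setminus S$ has at least $m$ neighbors in $S$. A $(k,m)$-CDS is a set $S\subseteq V$ that is $k$-connected and $m$-dominating. The unweighted $(k,m)$-CDS problem asks for a $(k,m)$-CDS of minimum cardinality. -}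

module Defs where

open import Algebra.Bundles using (CommutativeMonoid)
import Algebra.Properties.CommutativeSemigroup as CommSemigroup
open import Data.Bool using (Bool; true; false; if_then_else_; not)
open import Data.Fin using (Fin; toℕ; fromℕ<; remQuot)
open import Data.Fin.Subset using (Subset; _∈_; _∉_; _⊆_; _∩_; _─_; ∣_∣)
open import Data.Nat as ℕ using (ℕ; suc; _≡ᵇ_)
import Data.Nat.Properties as ℕₚ
open import Data.Nat.Logarithm using (⌈log₂_⌉)
open import Data.Product using (_×_; _,_; ∃; ∃-syntax; uncurry)
open import Data.Rational as ℚ using (ℚ; 0ℚ; 1ℚ; Positive; positive)
import Data.Rational.Properties as ℚₚ
open import Data.Sum using (_⊎_)
open import Data.Vec using (tabulate)
open import Function using (_⇔_)
open import Relation.Binary.Construct.Closure.ReflexiveTransitive using (Star)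
open import Relation.Binary.PropositionalEquality
  using (_≡_; _≢_; refl; sym; trans; cong; cong₂; subst; module ≡-Reasoning)
open import Relation.Nullary using (yes; no)

------------------------------------------------------------------------
-- Real numbers, as Cauchy sequences of rationals

IsCauchy : (ℕ → ℚ) → Set
IsCauchy s = ∀ ε → 0ℚ ℚ.< ε →
  ∃[ N ] ∀ i j → N ℕ.≤ i → N ℕ.≤ j → ℚ.∣ s i ℚ.- s j ∣ ℚ.≤ ε

record ℝ : Set where
  constructor mkℝ
  field
    seq    : ℕ → ℚ
    cauchy : IsCauchy seq

open ℝ public

private
  telescope : ∀ x y → x ≡ (x ℚ.- y) ℚ.+ y
  telescope x y = sym (trans (ℚₚ.+-assoc x (ℚ.- y) y)
    (trans (cong (x ℚ.+_) (ℚₚ.+-inverseˡ y)) (ℚₚ.+-identityʳ x)))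

  open CommSemigroup (CommutativeMonoid.commutativeSemigroup ℚₚ.+-0-commutativeMonoid)
    using () renaming (interchange to +-interchange)

  splitε : ∀ P Q → 0ℚ ℚ.< P → 0ℚ ℚ.< Q → ∀ ε → 0ℚ ℚ.< ε →
           ∃[ δ ] 0ℚ ℚ.< δ × P ℚ.* δ ℚ.+ Q ℚ.* δ ≡ ε
  splitε P Q 0<P 0<Q ε 0<ε = 1/R ℚ.* ε , ℚₚ.positive⁻¹ (1/R ℚ.* ε) , eq
    where
    R : ℚ
    R = P ℚ.+ Q
    instance
      P⁺ : Positive P
      P⁺ = positive 0<P
      Q⁺ : Positive Q
      Q⁺ = positive 0<Q
      ε⁺ : Positive ε
      ε⁺ = positive 0<ε
      R⁺ : Positive R
      R⁺ = ℚₚ.pos+pos⇒pos P Q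
      R≢0 : ℚ.NonZero R
      R≢0 = ℚₚ.pos⇒nonZero R
    1/R : ℚ
    1/R = ℚ.1/ R
    instance
      1/R⁺ : Positive 1/R
      1/R⁺ = ℚₚ.1/pos⇒pos R
      δ⁺ : Positive (1/R ℚ.* ε)
      δ⁺ = ℚₚ.pos*pos⇒pos 1/R ε
    eq : P ℚ.* (1/R ℚ.* ε) ℚ.+ Q ℚ.* (1/R ℚ.* ε) ≡ ε
    eq = trans (sym (ℚₚ.*-distribʳ-+ (1/R ℚ.* ε) P Q))
        (trans (sym (ℚₚ.*-assoc R 1/R ε))
        (trans (cong (ℚ._* ε) (ℚₚ.*-inverseʳ R)) (ℚₚ.*-identityˡ ε)))

  bounded : ∀ s → IsCauchy s →
            ∃[ B ] 0ℚ ℚ.< B × ∃[ N ] ∀ i → N ℕ.≤ i → ℚ.∣ s i ∣ ℚ.≤ B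
  bounded s c with c 1ℚ (ℚₚ.positive⁻¹ 1ℚ)
  ... | N , close = 1ℚ ℚ.+ ℚ.∣ s N ∣
                  , ℚₚ.+-mono-<-≤ (ℚₚ.positive⁻¹ 1ℚ) (ℚₚ.0≤∣p∣ (s N))
                  , N , bound
    where
    bound : ∀ i → N ℕ.≤ i → ℚ.∣ s i ∣ ℚ.≤ 1ℚ ℚ.+ ℚ.∣ s N ∣
    bound i N≤i = begin
      ℚ.∣ s i ∣                             ≡⟨ cong ℚ.∣_∣ (telescope (s i) (s N)) ⟩
      ℚ.∣ (s i ℚ.- s N) ℚ.+ s N ∣           ≤⟨ ℚₚ.∣p+q∣≤∣p∣+∣q∣ (s i ℚ.- s N) (s N) ⟩
      ℚ.∣ s i ℚ.- s N ∣ ℚ.+ ℚ.∣ s N ∣       ≤⟨ ℚₚ.+-monoˡ-≤ ℚ.∣ s N ∣ (close i N N≤i ℕₚ.≤-refl) ⟩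
      1ℚ ℚ.+ ℚ.∣ s N ∣                      ∎
      where
      open ℚₚ.≤-Reasoning

  *-mono-≤ : ∀ p q r s → 0ℚ ℚ.≤ q → 0ℚ ℚ.≤ r → p ℚ.≤ q → r ℚ.≤ s →
             p ℚ.* r ℚ.≤ q ℚ.* s
  *-mono-≤ p q r s 0≤q 0≤r p≤q r≤s = ℚₚ.≤-trans
    (ℚₚ.*-monoʳ-≤-nonNeg r {{ℚ.nonNegative 0≤r}} p≤q)
    (ℚₚ.*-monoˡ-≤-nonNeg q {{ℚ.nonNegative 0≤q}} r≤s)

  product-difference : ∀ a b a′ b′ →
    a ℚ.* b ℚ.- a′ ℚ.* b′ ≡ a ℚ.* (b ℚ.- b′) ℚ.+ b′ ℚ.* (a ℚ.- a′)
  product-difference a b a′ b′ = sym (begin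
    a ℚ.* (b ℚ.- b′) ℚ.+ b′ ℚ.* (a ℚ.- a′)
      ≡⟨ cong₂ ℚ._+_ (distrib a b b′) (distrib b′ a a′) ⟩
    (a ℚ.* b ℚ.- a ℚ.* b′) ℚ.+ (b′ ℚ.* a ℚ.- b′ ℚ.* a′)
      ≡⟨ cong₂ (λ x y → (a ℚ.* b ℚ.- x) ℚ.+ (b′ ℚ.* a ℚ.- y))
               (ℚₚ.*-comm a b′) (ℚₚ.*-comm b′ a′) ⟩
    (a ℚ.* b ℚ.- b′ ℚ.* a) ℚ.+ (b′ ℚ.* a ℚ.- a′ ℚ.* b′)
      ≡⟨ sym (ℚₚ.+-assoc (a ℚ.* b ℚ.- b′ ℚ.* a) (b′ ℚ.* a) (ℚ.- (a′ ℚ.* b′))) ⟩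
    ((a ℚ.* b ℚ.- b′ ℚ.* a) ℚ.+ b′ ℚ.* a) ℚ.- a′ ℚ.* b′
      ≡⟨ cong (ℚ._- a′ ℚ.* b′) (sym (telescope (a ℚ.* b) (b′ ℚ.* a))) ⟩
    a ℚ.* b ℚ.- a′ ℚ.* b′ ∎)
    where
    open ≡-Reasoning
    distrib : ∀ x y z → x ℚ.* (y ℚ.- z) ≡ x ℚ.* y ℚ.- x ℚ.* z
    distrib x y z = trans (ℚₚ.*-distribˡ-+ x y (ℚ.- z))
      (cong (x ℚ.* y ℚ.+_) (sym (ℚₚ.neg-distribʳ-* x z)))

  product-close : ∀ a b a′ b′ A B δ → 0ℚ ℚ.< A → 0ℚ ℚ.< B →
    ℚ.∣ a ∣ ℚ.≤ A → ℚ.∣ b′ ∣ ℚ.≤ B → ℚ.∣ a ℚ.- a′ ∣ ℚ.≤ δ → ℚ.∣ b ℚ.- b′ ∣ ℚ.≤ δ →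
    ℚ.∣ a ℚ.* b ℚ.- a′ ℚ.* b′ ∣ ℚ.≤ A ℚ.* δ ℚ.+ B ℚ.* δ
  product-close a b a′ b′ A B δ 0<A 0<B a≤A b′≤B a~a′ b~b′ =
    subst (λ x → ℚ.∣ x ∣ ℚ.≤ A ℚ.* δ ℚ.+ B ℚ.* δ) (sym (product-difference a b a′ b′))
      (ℚₚ.≤-trans (ℚₚ.∣p+q∣≤∣p∣+∣q∣ x y)
        (ℚₚ.+-mono-≤ {ℚ.∣ x ∣} {A ℚ.* δ} {ℚ.∣ y ∣} {B ℚ.* δ}
          (bound a (b ℚ.- b′) A 0<A a≤A b~b′)
          (bound b′ (a ℚ.- a′) B 0<B b′≤B a~a′)))
    where
    x = a ℚ.* (b ℚ.- b′)
    y = b′ ℚ.* (a ℚ.- a′)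
    bound : ∀ p q P → 0ℚ ℚ.< P → ℚ.∣ p ∣ ℚ.≤ P → ℚ.∣ q ∣ ℚ.≤ δ → ℚ.∣ p ℚ.* q ∣ ℚ.≤ P ℚ.* δ
    bound p q P 0<P p≤P q≤δ = subst (ℚ._≤ P ℚ.* δ) (sym (ℚₚ.∣p*q∣≡∣p∣*∣q∣ p q))
      (*-mono-≤ ℚ.∣ p ∣ P ℚ.∣ q ∣ δ (ℚₚ.<⇒≤ 0<P) (ℚₚ.0≤∣p∣ q) p≤P q≤δ)

fromℚ : ℚ → ℝ
fromℚ q = mkℝ (λ _ → q) λ ε 0<ε → 0 , λ _ _ _ _ →
  subst (ℚ._≤ ε) (sym (cong ℚ.∣_∣ (ℚₚ.+-inverseʳ q))) (ℚₚ.<⇒≤ 0<ε)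

1ℝ : ℝ
1ℝ = fromℚ 1ℚ

infixl 6 _+_ _-_
infixl 7 _*_
infix  4 _≤_

_+_ : ℝ → ℝ → ℝ
mkℝ s c + mkℝ t d = mkℝ (λ i → s i ℚ.+ t i) sum-cauchy
  where
  sum-cauchy : IsCauchy (λ i → s i ℚ.+ t i)
  sum-cauchy ε 0<ε with splitε 1ℚ 1ℚ (ℚₚ.positive⁻¹ 1ℚ) (ℚₚ.positive⁻¹ 1ℚ) ε 0<ε
  ... | δ , 0<δ , δ+δ≡ε with c δ 0<δ | d δ 0<δ
  ... | M , cM | N , dN = M ℕ.⊔ N , λ i j p q → begin
      ℚ.∣ (s i ℚ.+ t i) ℚ.- (s j ℚ.+ t j) ∣
        ≡⟨ cong ℚ.∣_∣ (regroup (s i) (t i) (s j) (t j)) ⟩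
      ℚ.∣ (s i ℚ.- s j) ℚ.+ (t i ℚ.- t j) ∣
        ≤⟨ ℚₚ.∣p+q∣≤∣p∣+∣q∣ (s i ℚ.- s j) (t i ℚ.- t j) ⟩
      ℚ.∣ s i ℚ.- s j ∣ ℚ.+ ℚ.∣ t i ℚ.- t j ∣
        ≤⟨ ℚₚ.+-mono-≤ (cM i j (ℕₚ.m⊔n≤o⇒m≤o M N p) (ℕₚ.m⊔n≤o⇒m≤o M N q))
                       (dN i j (ℕₚ.m⊔n≤o⇒n≤o M N p) (ℕₚ.m⊔n≤o⇒n≤o M N q)) ⟩
      δ ℚ.+ δ
        ≡⟨ sym (cong₂ ℚ._+_ (ℚₚ.*-identityˡ δ) (ℚₚ.*-identityˡ δ)) ⟩
      1ℚ ℚ.* δ ℚ.+ 1ℚ ℚ.* δ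
        ≡⟨ δ+δ≡ε ⟩
      ε ∎
    where
    open ℚₚ.≤-Reasoning
    regroup : ∀ a b a′ b′ → (a ℚ.+ b) ℚ.- (a′ ℚ.+ b′) ≡ (a ℚ.- a′) ℚ.+ (b ℚ.- b′)
    regroup a b a′ b′ = trans (cong ((a ℚ.+ b) ℚ.+_) (ℚₚ.neg-distrib-+ a′ b′))
                              (+-interchange a b (ℚ.- a′) (ℚ.- b′))

-_ : ℝ → ℝ
- mkℝ s c = mkℝ (λ i → ℚ.- s i) neg-cauchy
  where
  regroup : ∀ a b → (ℚ.- a) ℚ.- (ℚ.- b) ≡ ℚ.- (a ℚ.- b)
  regroup a b = sym (ℚₚ.neg-distrib-+ a (ℚ.- b))
  neg-cauchy : IsCauchy (λ i → ℚ.- s i)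
  neg-cauchy ε 0<ε with c ε 0<ε
  ... | N , cN = N , λ i j p q → subst (ℚ._≤ ε)
    (sym (trans (cong ℚ.∣_∣ (regroup (s i) (s j))) (ℚₚ.∣-p∣≡∣p∣ (s i ℚ.- s j))))
    (cN i j p q)

_-_ : ℝ → ℝ → ℝ
x - y = x + (- y)

_*_ : ℝ → ℝ → ℝ
mkℝ s c * mkℝ t d = mkℝ (λ i → s i ℚ.* t i) product-cauchy
  where
  product-cauchy : IsCauchy (λ i → s i ℚ.* t i)
  product-cauchy ε 0<ε =
    let A , 0<A , K , sA  = bounded s c
        B , 0<B , L , tB  = bounded t d
        δ , 0<δ , Aδ+Bδ≡ε = splitε A B 0<A 0<B ε 0<ε
        M , cM            = c δ 0<δ
        N , dN            = d δ 0<δ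
    in (K ℕ.⊔ L) ℕ.⊔ (M ℕ.⊔ N) , λ i j p q →
    let M⊔N≤i = ℕₚ.m⊔n≤o⇒n≤o (K ℕ.⊔ L) (M ℕ.⊔ N) p
        M⊔N≤j = ℕₚ.m⊔n≤o⇒n≤o (K ℕ.⊔ L) (M ℕ.⊔ N) q
        K≤i   = ℕₚ.m⊔n≤o⇒m≤o K L (ℕₚ.m⊔n≤o⇒m≤o (K ℕ.⊔ L) (M ℕ.⊔ N) p)
        L≤j   = ℕₚ.m⊔n≤o⇒n≤o K L (ℕₚ.m⊔n≤o⇒m≤o (K ℕ.⊔ L) (M ℕ.⊔ N) q)
    in subst (ℚ.∣ s i ℚ.* t i ℚ.- s j ℚ.* t j ∣ ℚ.≤_) Aδ+Bδ≡ε
         (product-close (s i) (t i) (s j) (t j) A B δ 0<A 0<B (sA i K≤i) (tB j L≤j)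
           (cM i j (ℕₚ.m⊔n≤o⇒m≤o M N M⊔N≤i) (ℕₚ.m⊔n≤o⇒m≤o M N M⊔N≤j))
           (dN i j (ℕₚ.m⊔n≤o⇒n≤o M N M⊔N≤i) (ℕₚ.m⊔n≤o⇒n≤o M N M⊔N≤j)))

_≤_ : ℝ → ℝ → Set
x ≤ y = ∀ ε → 0ℚ ℚ.< ε → ∃[ N ] ∀ i → N ℕ.≤ i → seq x i ℚ.≤ seq y i ℚ.+ ε

Point : Set
Point = ℝ × ℝ

distance² : Point → Point → ℝ
distance² (x , y) (x′ , y′) = (x - x′) * (x - x′) + (y - y′) * (y - y′)

------------------------------------------------------------------------
-- Finite simple graphs on the vertex set Fin n

record Graph (n : ℕ) : Set where
  field
    adj    : Fin n → Fin n → Bool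
    symm   : ∀ u v → adj u v ≡ adj v u
    irrefl : ∀ v → adj v v ≡ false

  Adj : Fin n → Fin n → Set
  Adj u v = adj u v ≡ true

  neighbours : Fin n → Subset n
  neighbours v = tabulate (adj v)

open Graph public

-- "Distance at most one" is expressed by the squared distance, which avoids
-- a square root. Distinct nodes may be placed at the same point.
UnitDisk : ∀ {n} → Graph n → Set
UnitDisk {n} G = ∃ λ (pos : Fin n → Point) → ∀ (u v : Fin n) → u ≢ v →
  Adj G u v ⇔ distance² (pos u) (pos v) ≤ 1ℝ

module _ {n : ℕ} (G : Graph n) where

  -- The edge relation of the induced subgraph G[S].
  InducedAdj : Subset n → Fin n → Fin n → Set
  InducedAdj S u v = u ∈ S × v ∈ S × Adj G u v

  Connected : Subset n → Set
  Connected S = ∀ u v → u ∈ S → v ∈ S → Star (InducedAdj S) u v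

  Complete : Subset n → Set
  Complete S = ∀ u v → u ∈ S → v ∈ S → u ≢ v → Adj G u v

  -- The right summand is the convention for small complete graphs.
  KConnected : ℕ → Subset n → Set
  KConnected k S =
    (∀ X → X ⊆ S → ∣ X ∣ ℕ.< k → Connected (S ─ X)) ⊎
    (Complete S × ∣ S ∣ ℕ.≤ k)

  MDominating : ℕ → Subset n → Set
  MDominating m S = ∀ v → v ∉ S → m ℕ.≤ ∣ neighbours G v ∩ S ∣

  IsCDS : ℕ → ℕ → Subset n → Set
  IsCDS k m S = KConnected k S × MDominating m S

  IsOPT : ℕ → ℕ → ℕ → Set
  IsOPT k m opt = (∃[ S ] IsCDS k m S × ∣ S ∣ ≡ opt) ×
                  (∀ S → IsCDS k m S → opt ℕ.≤ ∣ S ∣)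

------------------------------------------------------------------------
-- Model of computation: a structured random access machine.
--
-- A program uses finitely many scalar variables and unbounded arrays, all
-- holding natural numbers. Time is uniform cost. The only arithmetic
-- operations are addition and truncated subtraction, so each step lengthens
-- a number by O(1) bits, and polynomial time agrees with Turing machine
-- polynomial time; unit-cost multiplication would break this.

data Expr : Set where
  num       : ℕ → Expr
  var       : ℕ → Expr
  _[_]      : ℕ → Expr → Expr
  _⊕_ _⊖_   : Expr → Expr → Expr

infixr 4 _⨟_

data Program : Set where
  skip            : Program
  _≔_             : ℕ → Expr → Program
  _[_]≔_          : ℕ → Expr → Expr → Program
  _⨟_             : Program → Program → Program
  if_then_else_fi : Expr → Program → Program → Program
  while_repeat_end     : Expr → Program → Program

record State : Set where
  constructor ⟨_,_⟩
  field
    vars : ℕ → ℕ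
    arrs : ℕ → ℕ → ℕ

open State public

eval : State → Expr → ℕ
eval σ (num c)   = c
eval σ (var x)   = vars σ x
eval σ (a [ e ]) = arrs σ a (eval σ e)
eval σ (e ⊕ f)   = eval σ e ℕ.+ eval σ f
eval σ (e ⊖ f)   = eval σ e ℕ.∸ eval σ f

cost : Expr → ℕ
cost (num _)   = 1
cost (var _)   = 1
cost (_ [ e ]) = suc (cost e)
cost (e ⊕ f)   = suc (cost e ℕ.+ cost f)
cost (e ⊖ f)   = suc (cost e ℕ.+ cost f)

update : ∀ {A : Set} → ℕ → A → (ℕ → A) → ℕ → A
update i a f j = if i ≡ᵇ j then a else f j

setVar : ℕ → ℕ → State → State
setVar x c ⟨ ρ , μ ⟩ = ⟨ update x c ρ , μ ⟩

setCell : ℕ → ℕ → ℕ → State → State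
setCell a i c ⟨ ρ , μ ⟩ = ⟨ ρ , update a (update i c (μ a)) μ ⟩

infix 3 _,_⇓_,_

-- p , σ ⇓ τ , t : program p started in σ halts in τ after t time units.
data _,_⇓_,_ : Program → State → State → ℕ → Set where
  ⇓-skip : ∀ {σ} → skip , σ ⇓ σ , 1

  ⇓-var : ∀ {σ x e} → (x ≔ e) , σ ⇓ setVar x (eval σ e) σ , suc (cost e)

  ⇓-cell : ∀ {σ a e f} →
    (a [ e ]≔ f) , σ ⇓ setCell a (eval σ e) (eval σ f) σ , suc (cost e ℕ.+ cost f)

  ⇓-seq : ∀ {σ τ υ p q s t} → p , σ ⇓ τ , s → q , τ ⇓ υ , t →
    (p ⨟ q) , σ ⇓ υ , s ℕ.+ t

  ⇓-then : ∀ {σ τ e p q t} → eval σ e ≢ 0 → p , σ ⇓ τ , t →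
    if e then p else q fi , σ ⇓ τ , suc (cost e ℕ.+ t)

  ⇓-else : ∀ {σ τ e p q t} → eval σ e ≡ 0 → q , σ ⇓ τ , t →
    if e then p else q fi , σ ⇓ τ , suc (cost e ℕ.+ t)

  ⇓-stop : ∀ {σ e p} → eval σ e ≡ 0 →
    while e repeat p end , σ ⇓ σ , suc (cost e)

  ⇓-loop : ∀ {σ τ υ e p s t} → eval σ e ≢ 0 →
    p , σ ⇓ τ , s → while e repeat p end , τ ⇓ υ , t →
    while e repeat p end , σ ⇓ υ , suc (cost e ℕ.+ (s ℕ.+ t))

-- Only the graph is part of the input, not its embedding in the plane:
-- variables 0, 1, 2 hold n, k, m; cell n * u + v of array 0 is 1 if u and v
-- are adjacent; everything else is 0.
module _ {n : ℕ} (G : Graph n) where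

  adjCell : ℕ → ℕ
  adjCell i with i ℕ.<? n ℕ.* n
  ... | yes i<n² = if uncurry (adj G) (remQuot n (fromℕ< i<n²)) then 1 else 0
  ... | no  _    = 0

  input : ℕ → ℕ → State
  input k m = ⟨ inputVars , inputArrs ⟩
    where
    inputVars : ℕ → ℕ
    inputVars 0 = n
    inputVars 1 = k
    inputVars 2 = m
    inputVars _ = 0

    inputArrs : ℕ → ℕ → ℕ
    inputArrs 0 = adjCell
    inputArrs _ = λ _ → 0

-- The output set consists of the v < n with a non-zero cell v in array 1.
output : (n : ℕ) → State → Subset n
output n σ = tabulate λ v → not (arrs σ 1 (toℕ v) ≡ᵇ 0)

-- Bit length of the input: an adjacency matrix and k, m in binary.
inputSize : ℕ → ℕ → ℕ → ℕ
inputSize n k m = n ℕ.* n ℕ.+ ⌈log₂ suc k ⌉ ℕ.+ ⌈log₂ suc m ⌉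

{-# OPTIONS --safe #-}
module Submission where

-- Write u ~ v for "adjacent or equal". Processing the nodes in order and
-- keeping a node whenever it has fewer than t kept neighbours produces a
-- t-dominating set D_t that contains at most t nodes of any clique. In a unit
-- disk graph the nodes reachable by three ~-steps are covered by a constant
-- number W of cliques (cells of a grid), so double counting the edges between
-- D_t and an optimal solution gives |D_t| ≤ (W + 1) OPT for t ≤ m.
--
-- Take D = D_k, extended to an m-dominating set. It remains to add a set F
-- such that for all a, b in D and every X with |X| < k, if some path
-- a ~ w ~ w′ ~ b avoids X, then so does one with w, w′ in F: a path of G − X
-- can then be rerouted step by step through D and F, since every node outside
-- X has a ~-neighbour in D − X. For each pair a, b choose greedily up to k
-- disjoint pairs (w, w′). If there are k of them, X misses one. Otherwise every
-- such path meets a chosen node, and it suffices to keep, for each chosen node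
-- p, up to k common ~-neighbours of p with a and with b. Only W k nodes b
-- matter for each a, so |F| = O(k³) OPT, and k³ ≤ k 5^k.

open import Data.Bool using (Bool; true; false; if_then_else_; not; _∨_; T)
open import Data.Fin using (Fin; zero; suc; toℕ; fromℕ<; combine; remQuot; _≟_)
open import Data.Fin.Properties
  using (any?; fromℕ<-cong; fromℕ<-toℕ; remQuot-combine; toℕ-combine; toℕ-fromℕ<; toℕ-injective; toℕ<n)
open import Data.Fin.Subset
  using (Subset; _∈_; _∉_; _⊆_; _∩_; _─_; ∣_∣; inside; outside) renaming (⊥ to ∅)
open import Data.Fin.Subset.Properties
  using ( _∈?_; drop-there; p∩q⊆q; p─q⊆p; p⊂q⇒∣p∣<∣q∣; p⊆q⇒∣p∣≤∣q∣; x∈p∧x∉q⇒x∈p─q; x∈p∩q⁺; x∈p∩q⁻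
        ; ∉⊥; ∣p∩q∣≤∣p∣; ∣⊥∣≡0 )
open import Data.Integer as ℤ using (ℤ; +_)
import Data.Integer.DivMod as ℤDM
import Data.Integer.Properties as ℤₚ
import Data.Integer.Solver as ℤS
open import Data.Nat
  using (ℕ; zero; suc; _+_; _*_; _∸_; _^_; _⊔_; _≤_; _<_; _<?_; _<ᵇ_; _≡ᵇ_; z≤n; s≤s; >-nonZero)
open import Data.Nat.Logarithm using (⌈log₂_⌉)
open import Data.Nat.Properties hiding (_≟_)
open import Data.Nat.Solver using (module +-*-Solver)
open import Data.Product using (Σ-syntax; ∃-syntax; _×_; _,_; proj₁; proj₂; uncurry)
open import Data.Rational as ℚ using (ℚ; 0ℚ; 1ℚ; toℚᵘ; fromℚᵘ)
import Data.Rational.Properties as ℚₚ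
import Data.Rational.Solver as ℚS
import Data.Rational.Unnormalised as ℚᵘ
import Data.Rational.Unnormalised.Properties as ℚᵘₚ
open import Data.Sum using (_⊎_; inj₁; inj₂)
open import Data.Unit using (tt)
open import Data.Vec
  using (Vec; []; _∷_; here; there; lookup; tabulate) renaming (_[_]≔_ to _[_]←_)
open import Data.Vec.Properties
  using ( []=⇒lookup; lookup⇒[]=; lookup-replicate; lookup∘tabulate; lookup∘update; lookup∘update′
        ; tabulate-cong; tabulate∘lookup )
open import Function using (Equivalence; id; _∘_)
open import Relation.Binary.Construct.Closure.ReflexiveTransitive
  using (Star; ε; _◅_; _◅◅_; gmap; reverse)
open import Relation.Binary.PropositionalEquality hiding ([_])
open import Relation.Nullary
  using (Dec; yes; no; ⌊_⌋; contradiction; does; from-no; from-yes; _×-dec_)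
open import Algebra.Properties.CommutativeMonoid.Sum +-0-commutativeMonoid
  using (sum; ∑-comm; ∑-distrib-+)
open import Defs hiding (_+_; _*_; _-_; -_) renaming (_≤_ to _≤ᴿ_)

-- A small imperative language and its compilation

-- The output set, the dominating set, and the nodes of the matched pairs.
data Arr : Set where
  outₐ domₐ markₐ : Arr

arr# : Arr → ℕ
arr# outₐ  = 1
arr# domₐ  = 2
arr# markₐ = 3

data Param : Set where
  kₚ mₚ : Param

param# : Param → ℕ
param# kₚ = 1
param# mₚ = 2

data Test (d : ℕ) : Set where
  edge close  : Fin d → Fin d → Test d
  member free : Arr → Fin d → Test d
  below       : Param → Test d

infixr 4 _⨾_
infixr 5 when_⇒_

-- Commands inside d nested loops over the nodes; loop variables are de Bruijn
-- indices, and there is a single global counter.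
data Cmd (d : ℕ) : Set where
  reset inc : Cmd d
  put drop  : Arr → Fin d → Cmd d
  _⨾_       : Cmd d → Cmd d → Cmd d
  when_⇒_   : Test d → Cmd d → Cmd d
  each      : Cmd (suc d) → Cmd d

loop : ∀ {ℓ} {A : Set ℓ} {n} → (Fin n → A → A) → A → A
loop {n = zero}  f a = a
loop {n = suc n} f a = loop (f ∘ suc) (f zero a)

record Store (n : ℕ) : Set where
  constructor store
  field
    sets  : Arr → Subset n
    count : ℕ

open Store public

-- Arrays are compared through their numbers, as `setCell` does, so that both sides of the
-- simulation branch on the same test.
write : ∀ {n} → Arr → Fin n → Bool → Store n → Store n
write a v b (store S c) =
  store (λ a′ → if arr# a ≡ᵇ arr# a′ then S a′ [ v ]← b else S a′) c

adjacentOrEqual : ∀ {n} → Graph n → Fin n → Fin n → Bool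
adjacentOrEqual G u v = adj G u v ∨ ⌊ u ≟ v ⌋

module _ {n : ℕ} (G : Graph n) (k m : ℕ) where

  param : Param → ℕ
  param kₚ = k
  param mₚ = m

  holds : ∀ {d} → Test d → Vec (Fin n) d → Store n → Bool
  holds (edge i j)   ρ s = adj G (lookup ρ i) (lookup ρ j)
  holds (close i j)  ρ s = adjacentOrEqual G (lookup ρ i) (lookup ρ j)
  holds (member a i) ρ s = lookup (sets s a) (lookup ρ i)
  holds (free a i)   ρ s = not (lookup (sets s a) (lookup ρ i))
  holds (below p)    ρ s = count s <ᵇ param p

  ⟦_⟧ : ∀ {d} → Cmd d → Vec (Fin n) d → Store n → Store n
  ⟦ reset ⟧      ρ s = store (sets s) 0
  ⟦ inc ⟧        ρ s = store (sets s) (suc (count s))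
  ⟦ put a i ⟧    ρ s = write a (lookup ρ i) true s
  ⟦ drop a i ⟧   ρ s = write a (lookup ρ i) false s
  ⟦ c ⨾ c′ ⟧     ρ s = ⟦ c′ ⟧ ρ (⟦ c ⟧ ρ s)
  ⟦ when t ⇒ c ⟧ ρ s = if holds t ρ s then ⟦ c ⟧ ρ s else s
  ⟦ each c ⟧     ρ s = loop (λ v → ⟦ c ⟧ (v ∷ ρ)) s

-- Variable 3 is the counter; the loop at depth d keeps its index v in
-- variable top d and n * v in the next one, so that adjacency cells can be
-- addressed without multiplication.
top : ℕ → ℕ
top d = 4 + (d + d)

addr : ∀ {d} → Fin d → ℕ
addr {suc d} zero    = top d
addr {suc d} (suc i) = addr i

compileTest : ∀ {d} → Test d → Expr
compileTest (edge i j)   = 0 [ var (suc (addr i)) ⊕ var (addr j) ]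
-- The two truncated differences add up to the distance of the indices, so one minus their sum is 1
-- exactly for equal nodes; the outer `⊕` acts as a disjunction.
compileTest (close i j)  = (0 [ var (suc (addr i)) ⊕ var (addr j) ]) ⊕
  (num 1 ⊖ ((var (addr i) ⊖ var (addr j)) ⊕ (var (addr j) ⊖ var (addr i))))
compileTest (member a i) = arr# a [ var (addr i) ]
compileTest (free a i)   = num 1 ⊖ (arr# a [ var (addr i) ])
compileTest (below p)    = var (param# p) ⊖ var 3

compile : ∀ {d} → Cmd d → Program
compile         reset        = 3 ≔ num 0
compile         inc          = 3 ≔ (var 3 ⊕ num 1)
compile         (put a i)    = arr# a [ var (addr i) ]≔ num 1
compile         (drop a i)   = arr# a [ var (addr i) ]≔ num 0
compile         (c ⨾ c′)     = compile c ⨟ compile c′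
compile         (when t ⇒ c) = if compileTest t then compile c else skip fi
compile {d = d} (each c)     =
  top d ≔ num 0 ⨟ suc (top d) ≔ num 0 ⨟
  while var 0 ⊖ var (top d) repeat
    compile c ⨟ top d ≔ (var (top d) ⊕ num 1) ⨟
    suc (top d) ≔ (var (suc (top d)) ⊕ var 0)
  end

-- Polynomial running time

time : ∀ {d} → ℕ → Cmd d → ℕ
time n reset        = 2
time n inc          = 4
time n (put _ _)    = 3
time n (drop _ _)   = 3
time n (c ⨾ c′)     = time n c + time n c′
-- The inner `suc` pays for `skip` when the test fails.
time n (when t ⇒ c) = suc (cost (compileTest t) + suc (time n c))
-- Two initial assignments at 2 each and a failing guard at 4; every round adds 4 for its guard and
-- 4 for each of the two increments.
time n (each c)     = 2 + (2 + (n * (12 + time n c) + 4))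

-- The bound is a coefficient times a power of n + 1; as the base is positive, constants are
-- absorbed by any power. A sequence adds the degrees, which gives both summands a common power.
timeCoeff timeDegree : ∀ {d} → Cmd d → ℕ
timeCoeff reset        = 2
timeCoeff inc          = 4
timeCoeff (put _ _)    = 3
timeCoeff (drop _ _)   = 3
timeCoeff (c ⨾ c′)     = timeCoeff c + timeCoeff c′
timeCoeff (when t ⇒ c) = suc (cost (compileTest t)) + suc (timeCoeff c)
timeCoeff (each c)     = 20 + timeCoeff c
timeDegree (c ⨾ c′)     = timeDegree c + timeDegree c′
timeDegree (when t ⇒ c) = timeDegree c
timeDegree (each c)     = suc (timeDegree c)
timeDegree _            = 0

private
  m≤m*N^d : ∀ m N d → m ≤ m * suc N ^ d
  m≤m*N^d m N d = m≤m*n m (suc N ^ d) {{m^n≢0 (suc N) d}}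

time-polynomial : ∀ {d} n (c : Cmd d) →
  time n c ≤ timeCoeff c * suc n ^ timeDegree c
time-polynomial n reset      = ≤-refl
time-polynomial n inc        = ≤-refl
time-polynomial n (put _ _)  = ≤-refl
time-polynomial n (drop _ _) = ≤-refl
time-polynomial n (c ⨾ c′) = begin
  time n c + time n c′
    ≤⟨ +-mono-≤ (time-polynomial n c) (time-polynomial n c′) ⟩
  timeCoeff c * N ^ timeDegree c + timeCoeff c′ * N ^ timeDegree c′
    ≤⟨ +-mono-≤ (*-monoʳ-≤ (timeCoeff c) (^-monoʳ-≤ N (m≤m+n (timeDegree c) (timeDegree c′))))
                (*-monoʳ-≤ (timeCoeff c′) (^-monoʳ-≤ N (m≤n+m (timeDegree c′) (timeDegree c)))) ⟩
  timeCoeff c * N ^ (timeDegree c + timeDegree c′) + timeCoeff c′ * N ^ (timeDegree c + timeDegree c′)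
    ≡⟨ sym (*-distribʳ-+ (N ^ (timeDegree c + timeDegree c′)) (timeCoeff c) (timeCoeff c′)) ⟩
  (timeCoeff c + timeCoeff c′) * N ^ (timeDegree c + timeDegree c′) ∎
  where open ≤-Reasoning
        N = suc n
time-polynomial n (when t ⇒ c) = begin
  suc (e + suc (time n c))
    ≡⟨ cong suc (+-suc e (time n c)) ⟩
  suc (suc e) + time n c
    ≤⟨ +-mono-≤ (m≤m*N^d (suc (suc e)) n (timeDegree c)) (time-polynomial n c) ⟩
  suc (suc e) * N ^ timeDegree c + timeCoeff c * N ^ timeDegree c
    ≡⟨ sym (*-distribʳ-+ (N ^ timeDegree c) (suc (suc e)) (timeCoeff c)) ⟩
  (suc (suc e) + timeCoeff c) * N ^ timeDegree c
    ≡⟨ cong (λ x → suc x * N ^ timeDegree c) (sym (+-suc e (timeCoeff c))) ⟩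
  (suc e + suc (timeCoeff c)) * N ^ timeDegree c ∎
  where open ≤-Reasoning
        N = suc n
        e = cost (compileTest t)
time-polynomial n (each c) = begin
  2 + (2 + (n * (12 + time n c) + 4))
    ≤⟨ +-monoʳ-≤ 4 (+-monoˡ-≤ 4 (*-monoʳ-≤ n (+-mono-≤ (m≤m*N^d 12 n D) (time-polynomial n c)))) ⟩
  4 + (n * (12 * P + K * P) + 4)
    ≡⟨ solve 3 (λ n P K → con 4 :+ (n :* (con 12 :* P :+ K :* P) :+ con 4)
               := con 8 :+ (con 12 :+ K) :* (n :* P)) refl n P K ⟩
  8 + (12 + K) * (n * P)
    ≤⟨ +-mono-≤ (m≤m*N^d 8 n (suc D)) (*-monoʳ-≤ (12 + K) (*-monoˡ-≤ P (n≤1+n n))) ⟩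
  8 * (N * P) + (12 + K) * (N * P)
    ≡⟨ sym (*-distribʳ-+ (N * P) 8 (12 + K)) ⟩
  (20 + K) * (N * P) ∎
  where open ≤-Reasoning
        open +-*-Solver
        N = suc n
        D = timeDegree c
        K = timeCoeff c
        P = N ^ D

-- Correctness of the compilation

nonzero : ℕ → Bool
nonzero x = not (x ≡ᵇ 0)

nonzero-∸ : ∀ a b → nonzero (a ∸ b) ≡ (b <ᵇ a)
nonzero-∸ zero    zero    = refl
nonzero-∸ zero    (suc b) = refl
nonzero-∸ (suc a) zero    = refl
nonzero-∸ (suc a) (suc b) = nonzero-∸ a b

nonzero-1∸ : ∀ a → nonzero (1 ∸ a) ≡ not (nonzero a)
nonzero-1∸ zero          = refl
nonzero-1∸ (suc zero)    = refl
nonzero-1∸ (suc (suc a)) = refl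

nonzero-+ : ∀ a b → nonzero (a + b) ≡ nonzero a ∨ nonzero b
nonzero-+ zero    b = refl
nonzero-+ (suc a) b = refl

nonzero-if : ∀ b → nonzero (if b then 1 else 0) ≡ b
nonzero-if true  = refl
nonzero-if false = refl

nonzero⇒≢0 : ∀ {x} → nonzero x ≡ true → x ≢ 0
nonzero⇒≢0 () refl

zero⇒≡0 : ∀ {x} → nonzero x ≡ false → x ≡ 0
zero⇒≡0 {zero} _ = refl

equality-test : ∀ {n} (u v : Fin n) →
  not (nonzero ((toℕ u ∸ toℕ v) + (toℕ v ∸ toℕ u))) ≡ ⌊ u ≟ v ⌋
equality-test u v with u ≟ v
... | yes refl rewrite n∸n≡0 (toℕ u) = refl
... | no  u≢v  = go (toℕ u) (toℕ v) (u≢v ∘ toℕ-injective)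
  where
  go : ∀ a b → a ≢ b → not (nonzero ((a ∸ b) + (b ∸ a))) ≡ false
  go zero    zero    a≢b = contradiction refl a≢b
  go zero    (suc b) a≢b = refl
  go (suc a) zero    a≢b = refl
  go (suc a) (suc b) a≢b = go a b (a≢b ∘ cong suc)

update-≡ : ∀ {A : Set} i {x : A} f → update i x f i ≡ x
update-≡ i f with i ≡ᵇ i | ≡⇒≡ᵇ i i refl
... | true | _ = refl

update-≢ : ∀ {A : Set} i {x : A} f {j} → i ≢ j → update i x f j ≡ f j
update-≢ i f {j} i≢j with i ≡ᵇ j | ≡ᵇ⇒≡ i j
... | true  | eq = contradiction (eq _) i≢j
... | false | _  = refl

module _ {n : ℕ} (G : Graph n) where

  adjCell-combine : ∀ u v → adjCell G (toℕ u * n + toℕ v) ≡ (if adj G u v then 1 else 0)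
  adjCell-combine u v with toℕ u * n + toℕ v <? n * n
  ... | yes lt = cong (λ p → if p then 1 else 0) (begin
      uncurry (adj G) (remQuot n (fromℕ< lt))          ≡⟨ cong (uncurry (adj G) ∘ remQuot n) eq ⟩
      uncurry (adj G) (remQuot n (combine u v))        ≡⟨ cong (uncurry (adj G)) (remQuot-combine u v) ⟩
      adj G u v                                        ∎)
    where
    open ≡-Reasoning
    toℕ-eq : toℕ u * n + toℕ v ≡ toℕ (combine u v)
    toℕ-eq = sym (trans (toℕ-combine u v) (cong (_+ toℕ v) (*-comm n (toℕ u))))
    eq : fromℕ< lt ≡ combine u v
    eq = trans (fromℕ<-cong _ _ toℕ-eq lt (toℕ<n (combine u v))) (fromℕ<-toℕ (combine u v) _)
  ... | no ge = contradiction
    (subst (_< n * n) (trans (toℕ-combine u v) (cong (_+ toℕ v) (*-comm n (toℕ u)))) (toℕ<n (combine u v))) ge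

-- The two variables of every enclosing loop lie below `top d`, so opening a loop at depth `d`
-- overwrites none of them.
addr-bound : ∀ {d} (i : Fin d) → 2 + addr i ≤ top d
addr-bound {suc d} zero    = ≤-reflexive (cong (λ x → 5 + x) (sym (+-suc d d)))
addr-bound {suc d} (suc i) = ≤-trans (addr-bound i)
  (+-monoʳ-≤ 4 (+-mono-≤ (n≤1+n d) (n≤1+n d)))

module Correctness {n : ℕ} (G : Graph n) (k m : ℕ) where

  -- Simulation relation between machine states and stores. A set is read off the nonzero cells
  -- below `n`, in the way `output` reads array 1.
  record _⊨_ (σ : State) (s : Store n) : Set where
    field
      size    : vars σ 0 ≡ n
      params  : ∀ p → vars σ (param# p) ≡ param G k m p
      counter : vars σ 3 ≡ count s
      matrix  : ∀ i → arrs σ 0 i ≡ adjCell G i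
      arrays  : ∀ a v → nonzero (arrs σ (arr# a) (toℕ v)) ≡ lookup (sets s a) v

  open _⊨_

  LoopVar : State → ℕ → ℕ → Set
  LoopVar σ x v = vars σ x ≡ v × vars σ (suc x) ≡ v * n

  Env : ∀ {d} → State → Vec (Fin n) d → Set
  Env σ ρ = ∀ i → LoopVar σ (addr i) (toℕ (lookup ρ i))

  test-correct : ∀ {d} (t : Test d) ρ {σ s} → σ ⊨ s → Env σ ρ →
    nonzero (eval σ (compileTest t)) ≡ holds G k m t ρ s
  test-correct (edge i j) ρ {σ} R E
    rewrite proj₂ (E i) | proj₁ (E j) | matrix R (toℕ (lookup ρ i) * n + toℕ (lookup ρ j))
          | adjCell-combine G (lookup ρ i) (lookup ρ j) = nonzero-if _
  test-correct (close i j) ρ {σ} R E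
    rewrite proj₂ (E i) | proj₁ (E i) | proj₁ (E j)
          | matrix R (toℕ (lookup ρ i) * n + toℕ (lookup ρ j))
          | adjCell-combine G (lookup ρ i) (lookup ρ j) =
    trans (nonzero-+ (if adj G (lookup ρ i) (lookup ρ j) then 1 else 0) _)
      (cong₂ _∨_ (nonzero-if _) (trans
        (nonzero-1∸ ((toℕ (lookup ρ i) ∸ toℕ (lookup ρ j)) + (toℕ (lookup ρ j) ∸ toℕ (lookup ρ i))))
        (equality-test (lookup ρ i) (lookup ρ j))))
  test-correct (member a i) ρ R E rewrite proj₁ (E i) = arrays R a (lookup ρ i)
  test-correct (free a i) ρ {σ} R E rewrite proj₁ (E i) =
    trans (nonzero-1∸ (arrs σ (arr# a) (toℕ (lookup ρ i)))) (cong not (arrays R a (lookup ρ i)))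
  test-correct (below p) ρ R E rewrite params R p | counter R = nonzero-∸ (param G k m p) _

  -- The relation mentions only variables 0 to 3, and loop variables start at 4.
  setVar-⊨ : ∀ {σ s} x c → σ ⊨ s → setVar (4 + x) c σ ⊨ s
  setVar-⊨ x c R = record
    { size = size R ; params = λ { kₚ → params R kₚ ; mₚ → params R mₚ }
    ; counter = counter R ; matrix = matrix R ; arrays = arrays R }

  setVar-LoopVar : ∀ {σ x v} y c → 2 + x ≤ y → LoopVar σ x v → LoopVar (setVar y c σ) x v
  setVar-LoopVar {σ} {x} y c x<y (p , q) =
    trans (update-≢ y (vars σ) (λ { refl → <-irrefl refl (≤-trans (n≤1+n _) x<y) })) p ,
    trans (update-≢ y (vars σ) (λ { refl → <-irrefl refl x<y })) q

  setVar-Env : ∀ {d} σ (ρ : Vec (Fin n) d) y c → top d ≤ y → Env σ ρ → Env (setVar y c σ) ρ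
  setVar-Env σ ρ y c d≤y E i = setVar-LoopVar {σ} y c (≤-trans (addr-bound i) d≤y) (E i)

  -- Splitting `ρ` lets `addr` reduce to an index of at least 4, which the comparison with 3 settles
  -- by computation.
  counter-Env : ∀ {d} σ (ρ : Vec (Fin n) d) c → Env σ ρ → Env (setVar 3 c σ) ρ
  counter-Env σ (v ∷ ρ) c E zero    = E zero
  counter-Env σ (v ∷ ρ) c E (suc i) = counter-Env σ ρ c (E ∘ suc) i

  write-lookup : ∀ a v b (s : Store n) a′ w x → nonzero x ≡ b → (f : ℕ → ℕ) (μ : ℕ → ℕ → ℕ) →
    f ≡ μ (arr# a) →
    (∀ w → nonzero (μ (arr# a′) (toℕ w)) ≡ lookup (sets s a′) w) →
    nonzero (update (arr# a) (update (toℕ v) x f) μ (arr# a′) (toℕ w)) ≡ lookup (sets (write a v b s) a′) w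
  write-lookup a v b s a′ w x eq f μ refl R with arr# a ≡ᵇ arr# a′ | ≡ᵇ⇒≡ (arr# a) (arr# a′)
  ... | false | _ = R w
  ... | true  | same with v ≟ w
  ...   | yes refl = trans (cong nonzero (update-≡ (toℕ v) (μ (arr# a))))
                       (trans eq (sym (lookup∘update v (sets s a′) b)))
  ...   | no  v≢w  = trans (cong nonzero (trans (update-≢ (toℕ v) (μ (arr# a)) (v≢w ∘ toℕ-injective))
                                                (cong (λ y → μ y (toℕ w)) (same _))))
                       (trans (R w) (sym (lookup∘update′ (v≢w ∘ sym) (sets s a′) b)))

  write-⊨ : ∀ {σ s} a v b x → nonzero x ≡ b → σ ⊨ s → setCell (arr# a) (toℕ v) x σ ⊨ write a v b s
  write-⊨ {σ} {s} a v b x eq R = record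
    { size = size R ; params = params R ; counter = counter R
    ; matrix = λ i → trans (cong (λ f → f i) (matrix-array a)) (matrix R i)
    ; arrays = λ a′ w → write-lookup a v b s a′ w x eq _ (arrs σ) refl (arrays R a′) }
    where
    matrix-array : ∀ a → update (arr# a) (update (toℕ v) x (arrs σ (arr# a))) (arrs σ) 0 ≡ arrs σ 0
    matrix-array outₐ  = refl
    matrix-array domₐ  = refl
    matrix-array markₐ = refl

  Runs : ∀ {d} → Cmd d → Set
  Runs c = ∀ ρ {σ s} → σ ⊨ s → Env σ ρ →
    ∃[ τ ] ∃[ t ] (compile c , σ ⇓ τ , t) × τ ⊨ ⟦_⟧ G k m c ρ s × Env τ ρ × t ≤ time n c

  module Loop {d} (c : Cmd (suc d)) (body : Runs c) (ρ : Vec (Fin n) d) where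

    x : ℕ
    x = top d

    -- Stated for the last `r` rounds, with `f` enumerating the nodes from `j` on, so that induction
    -- on `r` follows the recursion of `loop` while the guard compares `j` with `n`.
    loop-correct : ∀ r (f : Fin r → Fin n) j → (∀ i → toℕ (f i) ≡ j + toℕ i) → j + r ≡ n →
      ∀ {σ s} → σ ⊨ s → Env σ ρ → LoopVar σ x j →
      ∃[ τ ] ∃[ t ] (while var 0 ⊖ var x repeat
          compile c ⨟ x ≔ (var x ⊕ num 1) ⨟ suc x ≔ (var (suc x) ⊕ var 0) end , σ ⇓ τ , t) ×
        τ ⊨ loop (λ i → ⟦_⟧ G k m c (f i ∷ ρ)) s × Env τ ρ × t ≤ r * (12 + time n c) + 4
    loop-correct zero f j f≡ j+r≡n {σ} R E (xj , _) =
      σ , 4 , ⇓-stop stop , R , E , ≤-refl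
      where
      stop : vars σ 0 ∸ vars σ x ≡ 0
      stop rewrite size R | xj | sym j+r≡n | +-identityʳ j = n∸n≡0 j
    loop-correct (suc r) f j f≡ j+r≡n {σ} {s} R E (xj , xjn) =
      τ₁ , _ , ⇓-loop go (⇓-seq run (⇓-seq ⇓-var ⇓-var)) run₁ , R₁ , E₁ , bound
      where
      f0≡j : toℕ (f zero) ≡ j
      f0≡j = trans (f≡ zero) (+-identityʳ j)
      E⁺ : Env σ (f zero ∷ ρ)
      E⁺ zero    = trans xj (sym f0≡j) , trans xjn (cong (_* n) (sym f0≡j))
      E⁺ (suc i) = E i
      go : vars σ 0 ∸ vars σ x ≢ 0
      go rewrite size R | xj | sym j+r≡n | m+n∸m≡n j (suc r) = λ ()
      step = body (f zero ∷ ρ) R E⁺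
      τ = proj₁ step
      t = proj₁ (proj₂ step)
      run = proj₁ (proj₂ (proj₂ step))
      Rτ = proj₁ (proj₂ (proj₂ (proj₂ step)))
      Eτ = proj₁ (proj₂ (proj₂ (proj₂ (proj₂ step))))
      t≤ = proj₂ (proj₂ (proj₂ (proj₂ (proj₂ step))))
      τ′ = setVar x (eval τ (var x ⊕ num 1)) τ
      τ″ = setVar (suc x) (eval τ′ (var (suc x) ⊕ var 0)) τ′
      R″ : τ″ ⊨ ⟦_⟧ G k m c (f zero ∷ ρ) s
      R″ = setVar-⊨ {τ′} (suc (d + d)) _ (setVar-⊨ {τ} (d + d) _ Rτ)
      E″ : Env τ″ ρ
      E″ = setVar-Env τ′ ρ (suc x) _ (n≤1+n x) (setVar-Env τ ρ x _ ≤-refl (Eτ ∘ suc))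
      V″ : LoopVar τ″ x (suc j)
      V″ = trans (update-≢ (suc x) (vars τ′) 1+n≢n)
             (trans (update-≡ x (vars τ))
               (trans (cong (_+ 1) (trans (proj₁ (Eτ zero)) f0≡j)) (+-comm j 1))) ,
           trans (update-≡ (suc x) (vars τ′))
             (trans (cong₂ _+_
                (trans (update-≢ x (vars τ) (1+n≢n ∘ sym)) (trans (proj₂ (Eτ zero)) (cong (_* n) f0≡j)))
                (size Rτ))
               (+-comm (j * n) n))
      rest = loop-correct r (f ∘ suc) (suc j) (λ i → trans (f≡ (suc i)) (+-suc j (toℕ i)))
               (trans (sym (+-suc j r)) j+r≡n) R″ E″ V″
      τ₁ = proj₁ rest
      t₁ = proj₁ (proj₂ rest)
      run₁ = proj₁ (proj₂ (proj₂ rest))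
      R₁ = proj₁ (proj₂ (proj₂ (proj₂ rest)))
      E₁ = proj₁ (proj₂ (proj₂ (proj₂ (proj₂ rest))))
      t₁≤ = proj₂ (proj₂ (proj₂ (proj₂ (proj₂ rest))))
      bound : suc (3 + ((t + 8) + t₁)) ≤ (12 + time n c) + r * (12 + time n c) + 4
      bound = begin
        4 + ((t + 8) + t₁)
          ≤⟨ +-monoʳ-≤ 4 (+-mono-≤ (+-monoˡ-≤ 8 t≤) t₁≤) ⟩
        4 + ((time n c + 8) + (r * (12 + time n c) + 4))
          ≡⟨ solve 2 (λ t q → con 4 :+ ((t :+ con 8) :+ (q :+ con 4)) := (con 12 :+ t) :+ q :+ con 4)
               refl (time n c) (r * (12 + time n c)) ⟩
        (12 + time n c) + r * (12 + time n c) + 4 ∎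
        where open ≤-Reasoning
              open +-*-Solver

  compile-correct : ∀ {d} (c : Cmd d) → Runs c
  compile-correct reset ρ {σ} R E = _ , _ , ⇓-var ,
    record { size = size R ; params = λ { kₚ → params R kₚ ; mₚ → params R mₚ } ; counter = refl
           ; matrix = matrix R ; arrays = arrays R } , counter-Env σ ρ 0 E , ≤-refl
  compile-correct inc ρ {σ} {s} R E = _ , _ , ⇓-var ,
    record { size = size R ; params = λ { kₚ → params R kₚ ; mₚ → params R mₚ }
           ; counter = trans (cong (_+ 1) (counter R)) (+-comm (count s) 1)
           ; matrix = matrix R ; arrays = arrays R } , counter-Env σ ρ _ E , ≤-refl
  compile-correct (put a i) ρ {σ} {s} R E = _ , _ , ⇓-cell ,
    subst (λ v → setCell (arr# a) v 1 σ ⊨ write a (lookup ρ i) true s) (sym (proj₁ (E i)))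
      (write-⊨ {σ} a (lookup ρ i) true 1 refl R) , E , ≤-refl
  compile-correct (drop a i) ρ {σ} {s} R E = _ , _ , ⇓-cell ,
    subst (λ v → setCell (arr# a) v 0 σ ⊨ write a (lookup ρ i) false s) (sym (proj₁ (E i)))
      (write-⊨ {σ} a (lookup ρ i) false 0 refl R) , E , ≤-refl
  compile-correct (c ⨾ c′) ρ R E with compile-correct c ρ R E
  ... | _ , _ , run , R₁ , E₁ , t≤ with compile-correct c′ ρ R₁ E₁
  ... | _ , _ , run′ , R₂ , E₂ , t′≤ = _ , _ , ⇓-seq run run′ , R₂ , E₂ , +-mono-≤ t≤ t′≤
  compile-correct (when t ⇒ c) ρ {σ} {s} R E with holds G k m t ρ s in eq
  ... | true with compile-correct c ρ R E
  ...   | _ , _ , run , R₁ , E₁ , t≤ = _ , _ ,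
    ⇓-then (nonzero⇒≢0 (trans (test-correct t ρ R E) eq)) run , R₁ , E₁ ,
    s≤s (+-monoʳ-≤ (cost (compileTest t)) (m≤n⇒m≤1+n t≤))
  compile-correct (when t ⇒ c) ρ {σ} {s} R E | false = _ , _ ,
    ⇓-else (zero⇒≡0 (trans (test-correct t ρ R E) eq)) ⇓-skip , R , E ,
    s≤s (+-monoʳ-≤ (cost (compileTest t)) (s≤s z≤n))
  compile-correct {d} (each c) ρ {σ} R E
    with Loop.loop-correct c (compile-correct c) ρ n (λ i → i) 0 (λ _ → refl) refl
           (setVar-⊨ {setVar (top d) 0 σ} (suc (d + d)) 0 (setVar-⊨ {σ} (d + d) 0 R))
           (setVar-Env (setVar (top d) 0 σ) ρ (suc (top d)) 0 (n≤1+n (top d)) (setVar-Env σ ρ (top d) 0 ≤-refl E))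
           ( trans (update-≢ (suc (top d)) (update (top d) 0 (vars σ)) 1+n≢n) (update-≡ (top d) (vars σ))
           , update-≡ (suc (top d)) (update (top d) 0 (vars σ)))
  ... | _ , _ , run , R₁ , E₁ , t≤ =
    _ , _ , ⇓-seq ⇓-var (⇓-seq ⇓-var run) , R₁ , E₁ , +-monoʳ-≤ 2 (+-monoʳ-≤ 2 t≤)

-- Loops and finite sums

if-elim : ∀ {ℓ ℓ′} {A : Set ℓ} (P : A → Set ℓ′) b {x y} →
          (b ≡ true → P x) → (b ≡ false → P y) → P (if b then x else y)
if-elim P true  t f = t refl
if-elim P false t f = f refl

loop-induction : ∀ {ℓ ℓ′} {A : Set ℓ} {n} (Inv : ℕ → A → Set ℓ′) (f : Fin n → A → A) →
  (∀ i {a} → Inv (toℕ i) a → Inv (suc (toℕ i)) (f i a)) →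
  ∀ {a} → Inv 0 a → Inv n (loop f a)
loop-induction {n = zero}  Inv f step base = base
loop-induction {n = suc n} Inv f step base =
  loop-induction (Inv ∘ suc) (f ∘ suc) (step ∘ suc) (step zero base)

-- Round `i` establishes `P i` and no round destroys an instance that already holds, so all of them
-- hold at the end.
loop-each : ∀ {ℓ} {A : Set ℓ} {n} (Inv : A → Set) (P : Fin n → A → Set) (f : Fin n → A → A) →
  (∀ i {a} → Inv a → Inv (f i a) × P i (f i a) × (∀ j → P j a → P j (f i a))) →
  ∀ {a} → Inv a → Inv (loop f a) × (∀ i → P i (loop f a))
loop-each {n = n} Inv P f step base = proj₁ result , λ i → proj₂ result i (toℕ<n i)
  where
  result = loop-induction (λ j a → Inv a × ∀ i → toℕ i < j → P i a) f
    (λ i (inv , done) → let inv′ , new , keep = step i inv in inv′ , λ j j<1+i →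
      split i j new (λ j<i → keep j (done j j<i)) (m<1+n⇒m<n∨m≡n j<1+i))
    (base , λ _ ())
    where
    split : ∀ i j {a} → P i a → (toℕ j < toℕ i → P j a) → toℕ j < toℕ i ⊎ toℕ j ≡ toℕ i → P j a
    split i j new old (inj₁ j<i) = old j<i
    split i j new old (inj₂ j≡i) rewrite toℕ-injective j≡i = new

loop-growth : ∀ {ℓ} {A : Set ℓ} {n} (Inv : A → Set) (μ : A → ℕ) (g : Fin n → ℕ) (f : Fin n → A → A) →
  (∀ i {a} → Inv a → Inv (f i a) × μ (f i a) ≤ μ a + g i) →
  ∀ {a} → Inv a → μ (loop f a) ≤ μ a + sum g
loop-growth {n = zero}  Inv μ g f step {a} inv = m≤m+n (μ a) 0
loop-growth {n = suc n} Inv μ g f step {a} inv = begin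
  μ (loop (f ∘ suc) (f zero a)) ≤⟨ loop-growth Inv μ (g ∘ suc) (f ∘ suc) (step ∘ suc) (proj₁ (step zero inv)) ⟩
  μ (f zero a) + sum (g ∘ suc)  ≤⟨ +-monoˡ-≤ (sum (g ∘ suc)) (proj₂ (step zero inv)) ⟩
  μ a + g zero + sum (g ∘ suc)  ≡⟨ +-assoc (μ a) (g zero) (sum (g ∘ suc)) ⟩
  μ a + sum g                   ∎
  where open ≤-Reasoning

sum-mono-≤ : ∀ {n} {f g : Fin n → ℕ} → (∀ i → f i ≤ g i) → sum f ≤ sum g
sum-mono-≤ {zero}  f≤g = z≤n
sum-mono-≤ {suc n} f≤g = +-mono-≤ (f≤g zero) (sum-mono-≤ (f≤g ∘ suc))

term≤sum : ∀ {n} (f : Fin n → ℕ) i → f i ≤ sum f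
term≤sum f zero    = m≤m+n (f zero) _
term≤sum f (suc i) = ≤-trans (term≤sum (f ∘ suc) i) (m≤n+m _ (f zero))

sum-const : ∀ n c → sum {n} (λ _ → c) ≡ n * c
sum-const zero    c = refl
sum-const (suc n) c = cong (λ x → c + x) (sum-const n c)

𝟙 : Bool → ℕ
𝟙 b = if b then 1 else 0

sum-member : ∀ {n} (S : Subset n) c → sum (λ v → 𝟙 (lookup S v) * c) ≡ ∣ S ∣ * c
sum-member []            c = refl
sum-member (inside  ∷ S) c = cong₂ _+_ (*-identityˡ c) (sum-member S c)
sum-member (outside ∷ S) c = sum-member S c

∣S∣≡sum : ∀ {n} (S : Subset n) → ∣ S ∣ ≡ sum (λ v → 𝟙 (lookup S v))
∣S∣≡sum []            = refl
∣S∣≡sum (inside  ∷ S) = cong suc (∣S∣≡sum S)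
∣S∣≡sum (outside ∷ S) = ∣S∣≡sum S

∈⇒𝟙≡1 : ∀ {n} {S : Subset n} {v} → v ∈ S → 𝟙 (lookup S v) ≡ 1
∈⇒𝟙≡1 v∈S rewrite []=⇒lookup v∈S = refl

𝟙*-≤ : ∀ {n} {S : Subset n} {v x y} → (v ∈ S → x ≤ y) → 𝟙 (lookup S v) * x ≤ y
𝟙*-≤ {S = S} {v} {x} {y} h = if-elim (λ i → i * x ≤ y) (lookup S v)
  (λ eq → ≤-trans (≤-reflexive (*-identityˡ x)) (h (lookup⇒[]= v S eq))) (λ _ → z≤n)

𝟙-≤ : ∀ {n} {S : Subset n} {v y} → (v ∈ S → 1 ≤ y) → 𝟙 (lookup S v) ≤ y
𝟙-≤ {S = S} h = ≤-trans (≤-reflexive (sym (*-identityʳ _))) (𝟙*-≤ {S = S} h)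

-- Every member of `P` is counted at least once in the double sum; exchanging the sums groups the
-- count by covering sets.
union-bound : ∀ {n W} (P : Subset n) (Q : Fin W → Subset n) b →
  (∀ {v} → v ∈ P → ∃[ c ] v ∈ Q c) → (∀ c → ∣ Q c ∩ P ∣ ≤ b) → ∣ P ∣ ≤ W * b
union-bound {n} {W} P Q b covers small = begin
  ∣ P ∣                                            ≡⟨ ∣S∣≡sum P ⟩
  sum (λ v → 𝟙 (lookup P v))                       ≤⟨ sum-mono-≤ pointwise ⟩
  sum (λ v → sum λ c → 𝟙 (lookup (Q c ∩ P) v))     ≡⟨ ∑-comm (λ v c → 𝟙 (lookup (Q c ∩ P) v)) ⟩
  sum (λ c → sum λ v → 𝟙 (lookup (Q c ∩ P) v))     ≤⟨ sum-mono-≤ (λ c → subst (_≤ b) (∣S∣≡sum (Q c ∩ P)) (small c)) ⟩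
  sum {W} (λ _ → b)                                ≡⟨ sum-const W b ⟩
  W * b                                            ∎
  where
  open ≤-Reasoning
  pointwise : ∀ v → 𝟙 (lookup P v) ≤ sum (λ c → 𝟙 (lookup (Q c ∩ P) v))
  pointwise v = 𝟙-≤ {S = P} λ v∈P →
    let c , v∈Q = covers v∈P in
    ≤-trans (≤-reflexive (sym (∈⇒𝟙≡1 {S = Q c ∩ P} (x∈p∩q⁺ (v∈Q , v∈P)))))
            (term≤sum (λ c → 𝟙 (lookup (Q c ∩ P) v)) c)

-- Pigeonhole. It supplies a neighbour outside a removed set of fewer than `k` nodes and, taken with
-- the empty set, a member of a nonempty set.
∃∈∖ : ∀ {n} (X Y : Subset n) → ∣ X ∣ < ∣ Y ∣ → ∃[ v ] v ∈ Y × v ∉ X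
∃∈∖ []            []            ()
∃∈∖ (outside ∷ X) (inside  ∷ Y) _       = zero , here , λ ()
∃∈∖ (inside  ∷ X) (inside  ∷ Y) (s≤s p) = let v , v∈Y , v∉X = ∃∈∖ X Y p in suc v , there v∈Y , v∉X ∘ drop-there
∃∈∖ (inside  ∷ X) (outside ∷ Y) p       = let v , v∈Y , v∉X = ∃∈∖ X Y (<⇒≤ p) in suc v , there v∈Y , v∉X ∘ drop-there
∃∈∖ (outside ∷ X) (outside ∷ Y) p       = let v , v∈Y , v∉X = ∃∈∖ X Y p in suc v , there v∈Y , v∉X ∘ drop-there

-- Insertion, deletion and prefix counts

module _ {n} {S : Subset n} where

  ∈-insert : ∀ v → v ∈ S [ v ]← true
  ∈-insert v = lookup⇒[]= v _ (lookup∘update v S true)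

  insert-⊆ : ∀ v → S ⊆ S [ v ]← true
  insert-⊆ v {u} u∈S with u ≟ v
  ... | yes refl = ∈-insert u
  ... | no  u≢v  = lookup⇒[]= u _ (trans (lookup∘update′ u≢v S true) ([]=⇒lookup u∈S))

  ∈-insert⁻ : ∀ {v u} → u ∈ S [ v ]← true → u ∈ S ⊎ u ≡ v
  ∈-insert⁻ {v} {u} u∈ with u ≟ v
  ... | yes refl = inj₂ refl
  ... | no  u≢v  = inj₁ (lookup⇒[]= u _ (trans (sym (lookup∘update′ u≢v S true)) ([]=⇒lookup u∈)))

  ∉-delete : ∀ v → v ∉ S [ v ]← false
  ∉-delete v v∈ with trans (sym (lookup∘update v S false)) ([]=⇒lookup v∈)
  ... | ()

  ∈-delete⁻ : ∀ {v u} → u ∈ S [ v ]← false → u ∈ S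
  ∈-delete⁻ {v} {u} u∈ with u ≟ v
  ... | yes refl = contradiction u∈ (∉-delete u)
  ... | no  u≢v  = lookup⇒[]= u _ (trans (sym (lookup∘update′ u≢v S false)) ([]=⇒lookup u∈))

∣insert∣≤ : ∀ {n} (S : Subset n) v → ∣ S [ v ]← true ∣ ≤ suc ∣ S ∣
∣insert∣≤ (inside  ∷ S) zero    = n≤1+n _
∣insert∣≤ (outside ∷ S) zero    = ≤-refl
∣insert∣≤ (inside  ∷ S) (suc v) = s≤s (∣insert∣≤ S v)
∣insert∣≤ (outside ∷ S) (suc v) = ∣insert∣≤ S v

∣insert∣≡ : ∀ {n} (S : Subset n) v → v ∉ S → ∣ S [ v ]← true ∣ ≡ suc ∣ S ∣
∣insert∣≡ (inside  ∷ S) zero    v∉S = contradiction here v∉S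
∣insert∣≡ (outside ∷ S) zero    v∉S = refl
∣insert∣≡ (inside  ∷ S) (suc v) v∉S = cong suc (∣insert∣≡ S v (v∉S ∘ there))
∣insert∣≡ (outside ∷ S) (suc v) v∉S = ∣insert∣≡ S v (v∉S ∘ there)

lookup⇒∉ : ∀ {n} {S : Subset n} {v} → lookup S v ≡ false → v ∉ S
lookup⇒∉ eq v∈S with trans (sym eq) ([]=⇒lookup v∈S)
... | ()

-- Lets a loop invariant compare a counter with the part of a set that the loop has already visited.
prefix : ∀ {n} → ℕ → Subset n → ℕ
prefix zero    S             = 0
prefix (suc j) []            = 0
prefix (suc j) (inside  ∷ S) = suc (prefix j S)
prefix (suc j) (outside ∷ S) = prefix j S

prefix-all : ∀ {n} (S : Subset n) → prefix n S ≡ ∣ S ∣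
prefix-all []            = refl
prefix-all (inside  ∷ S) = cong suc (prefix-all S)
prefix-all (outside ∷ S) = prefix-all S

prefix-∈ : ∀ {n} {S : Subset n} {v} → v ∈ S → prefix (suc (toℕ v)) S ≡ suc (prefix (toℕ v) S)
prefix-∈ {S = inside  ∷ S} {zero}  here        = refl
prefix-∈ {S = inside  ∷ S} {suc v} (there v∈S) = cong suc (prefix-∈ v∈S)
prefix-∈ {S = outside ∷ S} {suc v} (there v∈S) = prefix-∈ v∈S

prefix-∉ : ∀ {n} {S : Subset n} {v} → v ∉ S → prefix (suc (toℕ v)) S ≡ prefix (toℕ v) S
prefix-∉ {S = inside  ∷ S} {zero}  v∉S = contradiction here v∉S
prefix-∉ {S = outside ∷ S} {zero}  v∉S = refl
prefix-∉ {S = inside  ∷ S} {suc v} v∉S = cong suc (prefix-∉ (v∉S ∘ there))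
prefix-∉ {S = outside ∷ S} {suc v} v∉S = prefix-∉ (v∉S ∘ there)

prefix-mono : ∀ {n} (S : Subset n) v → prefix (toℕ v) S ≤ prefix (suc (toℕ v)) S
prefix-mono S v with v ∈? S
... | yes v∈S = ≤-trans (n≤1+n _) (≤-reflexive (sym (prefix-∈ v∈S)))
... | no  v∉S = ≤-reflexive (sym (prefix-∉ v∉S))

-- Double counting against a dominating set

module _ {n} (G : Graph n) where

  ∈-neighbours⁺ : ∀ {u v} → Adj G u v → v ∈ neighbours G u
  ∈-neighbours⁺ {u} {v} uv = lookup⇒[]= v _ (trans (lookup∘tabulate (adj G u) v) uv)

  ∈-neighbours⁻ : ∀ {u v} → v ∈ neighbours G u → Adj G u v
  ∈-neighbours⁻ {u} {v} v∈ = trans (sym (lookup∘tabulate (adj G u) v)) ([]=⇒lookup v∈)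

  Adj-sym : ∀ {u v} → Adj G u v → Adj G v u
  Adj-sym {u} {v} uv = trans (symm G v u) uv

  -- Charge `thr` to every member of `T`. A member in `D` is paid by the first summand of `rows`;
  -- any other has `thr` neighbours in `D`, and a node of `D` receives at most `W * thr` of these
  -- edges. Hence |T| thr ≤ |D| thr + |D| W thr, and `thr` cancels.
  dominating-bound : ∀ (T D : Subset n) thr W → 1 ≤ thr → MDominating G thr D →
    (∀ d → ∣ neighbours G d ∩ T ∣ ≤ W * thr) → ∣ T ∣ ≤ suc W * ∣ D ∣
  dominating-bound T D thr W 1≤thr dom sparse =
    *-cancelʳ-≤ ∣ T ∣ (suc W * ∣ D ∣) thr {{>-nonZero 1≤thr}} (begin
      ∣ T ∣ * thr
        ≡⟨ sum-member T thr ⟨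
      sum (λ v → 𝟙 (lookup T v) * thr)
        ≤⟨ sum-mono-≤ rows ⟩
      sum (λ v → 𝟙 (lookup D v) * thr + sum (e v))
        ≡⟨ ∑-distrib-+ (λ v → 𝟙 (lookup D v) * thr) (λ v → sum (e v)) ⟩
      sum (λ v → 𝟙 (lookup D v) * thr) + sum (λ v → sum (e v))
        ≡⟨ cong₂ _+_ (sum-member D thr) (∑-comm e) ⟩
      ∣ D ∣ * thr + sum (λ d → sum (λ v → e v d))
        ≤⟨ +-monoʳ-≤ (∣ D ∣ * thr) (sum-mono-≤ columns) ⟩
      ∣ D ∣ * thr + sum (λ d → 𝟙 (lookup D d) * (W * thr))
        ≡⟨ cong (λ x → ∣ D ∣ * thr + x) (sum-member D (W * thr)) ⟩
      ∣ D ∣ * thr + ∣ D ∣ * (W * thr)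
        ≡⟨ *-distribˡ-+ ∣ D ∣ thr (W * thr) ⟨
      ∣ D ∣ * (suc W * thr)
        ≡⟨ *-assoc ∣ D ∣ (suc W) thr ⟨
      ∣ D ∣ * suc W * thr
        ≡⟨ cong (_* thr) (*-comm ∣ D ∣ (suc W)) ⟩
      suc W * ∣ D ∣ * thr ∎)
    where
    open ≤-Reasoning
    e : Fin n → Fin n → ℕ
    e v d = 𝟙 (lookup T v) * 𝟙 (lookup (neighbours G v ∩ D) d)
    rows : ∀ v → 𝟙 (lookup T v) * thr ≤ 𝟙 (lookup D v) * thr + sum (e v)
    rows v = 𝟙*-≤ {S = T} λ v∈T → case v∈T (v ∈? D)
      where
      case : v ∈ T → Dec (v ∈ D) → thr ≤ 𝟙 (lookup D v) * thr + sum (e v)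
      case v∈T (yes v∈D) = ≤-trans
        (≤-reflexive (trans (sym (*-identityˡ thr)) (cong (_* thr) (sym (∈⇒𝟙≡1 {S = D} v∈D)))))
        (m≤m+n _ _)
      case v∈T (no v∉D) = begin
        thr                                                ≤⟨ dom v v∉D ⟩
        ∣ neighbours G v ∩ D ∣                             ≡⟨ ∣S∣≡sum (neighbours G v ∩ D) ⟩
        sum (λ d → 𝟙 (lookup (neighbours G v ∩ D) d))
          ≤⟨ sum-mono-≤ (λ d → ≤-reflexive (trans (sym (*-identityˡ _))
               (cong (_* 𝟙 (lookup (neighbours G v ∩ D) d)) (sym (∈⇒𝟙≡1 {S = T} v∈T))))) ⟩
        sum (e v)                                          ≤⟨ m≤n+m _ _ ⟩
        𝟙 (lookup D v) * thr + sum (e v)                   ∎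
    entry : ∀ v d → e v d ≤ 𝟙 (lookup D d) * 𝟙 (lookup (neighbours G d ∩ T) v)
    entry v d = 𝟙*-≤ {S = T} λ v∈T → 𝟙-≤ {S = neighbours G v ∩ D} λ d∈ →
      let d∈N , d∈D = x∈p∩q⁻ (neighbours G v) D d∈ in
      ≤-reflexive (sym (cong₂ _*_ (∈⇒𝟙≡1 {S = D} d∈D)
        (∈⇒𝟙≡1 {S = neighbours G d ∩ T} (x∈p∩q⁺ (∈-neighbours⁺ (Adj-sym (∈-neighbours⁻ d∈N)) , v∈T)))))
    columns : ∀ d → sum (λ v → e v d) ≤ 𝟙 (lookup D d) * (W * thr)
    -- The entries are abstracted together with `lookup D d`, so that their leading factor becomes 0
    -- or 1 in each branch.
    columns d with lookup D d | (λ v → entry v d)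
    ... | false | es = ≤-trans (sum-mono-≤ es) (≤-reflexive (trans (sum-const n 0) (*-zeroʳ n)))
    ... | true  | es = begin
      sum (λ v → e v d)                                  ≤⟨ sum-mono-≤ (λ v → ≤-trans (es v) (≤-reflexive (*-identityˡ _))) ⟩
      sum (λ v → 𝟙 (lookup (neighbours G d ∩ T) v))      ≡⟨ ∣S∣≡sum (neighbours G d ∩ T) ⟨
      ∣ neighbours G d ∩ T ∣                             ≤⟨ sparse d ⟩
      W * thr                                            ≡⟨ *-identityˡ _ ⟨
      1 * (W * thr)                                      ∎

-- The algorithm

-- Kept nodes go to `domₐ`, where neighbours are counted, and also to `outₐ`, which may already hold
-- linking nodes when the second pass runs.
grow : Param → Cmd 0
grow p = each (reset ⨾ each (when member domₐ zero ⇒ when edge (suc zero) zero ⇒ inc) ⨾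
               when below p ⇒ (put domₐ zero ⨾ put outₐ zero))

collect : ∀ {d} → Fin d → Fin d → Cmd d
collect i j = reset ⨾ each (when close (suc i) zero ⇒ when close zero (suc j) ⇒
  when below kₚ ⇒ (put outₐ zero ⨾ inc))

-- The nodes of a pair may coincide, since `close` includes equality, so a chosen pair marks one or
-- two nodes. Both are unmarked when the pair is chosen, which keeps the pairs disjoint.
matching : ∀ {d} → Fin d → Fin d → Cmd d
matching i j = reset ⨾ each (when close (suc i) zero ⇒ each (
  when close (suc zero) zero ⇒ when close zero (suc (suc j)) ⇒
  when free markₐ (suc zero) ⇒ when free markₐ zero ⇒ when below kₚ ⇒
  (put markₐ (suc zero) ⨾ put markₐ zero ⨾ inc)))

-- A marked node can be the first or the second interior node of a path, hence one collection
-- towards each end.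
expand : ∀ {d} → Fin d → Fin d → Cmd d
expand i j = each (when member markₐ zero ⇒
  (put outₐ zero ⨾ collect zero (suc j) ⨾ collect zero (suc i)))

link : ∀ {d} → Fin d → Fin d → Cmd d
link i j = each (drop markₐ zero) ⨾ matching i j ⨾ expand i j

linkAll : Cmd 0
linkAll = each (when member domₐ zero ⇒ each (when member domₐ zero ⇒ link (suc zero) zero))

-- Linking precedes the second pass: it then runs over a set with at most `k` members in each
-- clique, and the bound on its cost does not involve `m`.
algorithm : Cmd 0
algorithm = grow kₚ ⨾ linkAll ⨾ grow mₚ

-- What the commands compute

<ᵇ-true : ∀ {a b} → (a <ᵇ b) ≡ true → a < b
<ᵇ-true {a} {b} eq = <ᵇ⇒< a b (subst T (sym eq) tt)

<ᵇ-false : ∀ {a b} → (a <ᵇ b) ≡ false → b ≤ a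
<ᵇ-false eq = ≮⇒≥ λ a<b → subst T eq (<⇒<ᵇ a<b)

not-true : ∀ {b} → not b ≡ true → b ≡ false
not-true {false} _ = refl

not-false : ∀ {b} → not b ≡ false → b ≡ true
not-false {true} _ = refl

module Semantics {n : ℕ} (G : Graph n) (k m : ℕ) where

  run : ∀ {d} → Cmd d → Vec (Fin n) d → Store n → Store n
  run = ⟦_⟧ G k m

  infix 4 _~_
  _~_ : Fin n → Fin n → Set
  u ~ v = adjacentOrEqual G u v ≡ true

  Adj⇒~ : ∀ {u v} → Adj G u v → u ~ v
  Adj⇒~ uv rewrite uv = refl

  ~-refl : ∀ {u} → u ~ u
  ~-refl {u} with adj G u u | u ≟ u
  ... | true  | _       = refl
  ... | false | yes _   = refl
  ... | false | no  u≢u = contradiction refl u≢u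

  ~⇒≡⊎Adj : ∀ {u v} → u ~ v → u ≡ v ⊎ Adj G u v
  ~⇒≡⊎Adj {u} {v} uv with adj G u v | u ≟ v
  ... | true  | _       = inj₂ refl
  ... | false | yes u≡v = inj₁ u≡v
  ~⇒≡⊎Adj {u} {v} () | false | no _

  ~-sym : ∀ {u v} → u ~ v → v ~ u
  ~-sym {u} {v} uv with ~⇒≡⊎Adj uv
  ... | inj₁ refl = uv
  ... | inj₂ a    = Adj⇒~ (Adj-sym G a)

  Reach : Fin n → Fin n → Set
  Reach a b = ∃[ w ] ∃[ w′ ] a ~ w × w ~ w′ × w′ ~ b

  Between : Fin n → Fin n → Subset n → Subset n → Set
  Between p q F X = ∃[ x ] x ∈ F × x ∉ X × p ~ x × x ~ q

  Detour : Fin n → Fin n → Subset n → Subset n → Set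
  Detour a b F X = ∃[ w ] ∃[ w′ ] (w ∈ F × w′ ∈ F) × (w ∉ X × w′ ∉ X) × a ~ w × w ~ w′ × w′ ~ b

  Linked : Fin n → Fin n → Subset n → Set
  Linked a b F = ∀ X → ∣ X ∣ < k → ∀ {w w′} → w ∉ X → w′ ∉ X →
    a ~ w → w ~ w′ → w′ ~ b → Detour a b F X

  -- The one-node analogue of `Linked`: what remains to be repaired once one interior node of the
  -- path is already in `F`.
  Joined : Fin n → Fin n → Subset n → Set
  Joined p q F = ∀ X → ∣ X ∣ < k → ∀ {x} → x ∉ X → p ~ x → x ~ q → Between p q F X

  Between-mono : ∀ {p q F F′ X} → F ⊆ F′ → Between p q F X → Between p q F′ X
  Between-mono F⊆F′ (x , x∈F , rest) = x , F⊆F′ x∈F , rest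

  Detour-mono : ∀ {a b F F′ X} → F ⊆ F′ → Detour a b F X → Detour a b F′ X
  Detour-mono F⊆F′ (w , w′ , (w∈F , w′∈F) , rest) = w , w′ , (F⊆F′ w∈F , F⊆F′ w′∈F) , rest

  Linked-mono : ∀ {a b F F′} → F ⊆ F′ → Linked a b F → Linked a b F′
  Linked-mono F⊆F′ L X small w∉X w′∉X p q r = Detour-mono F⊆F′ (L X small w∉X w′∉X p q r)

  Joined-mono : ∀ {p q F F′} → F ⊆ F′ → Joined p q F → Joined p q F′
  Joined-mono F⊆F′ J X small x∉X px xq = Between-mono F⊆F′ (J X small x∉X px xq)

  module Collect {d} (i j : Fin d) (ρ : Vec (Fin n) d) (s₀ : Store n) where

    p q : Fin n
    p = lookup ρ i
    q = lookup ρ j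

    F₀ : Subset n
    F₀ = sets s₀ outₐ

    -- The first alternative of avoid stands for all chosen nodes lying in X; as
    -- they are distinct, X then has count s elements among the first l nodes.
    record Inv (l : ℕ) (s : Store n) : Set where
      field
        dom-≡  : sets s domₐ ≡ sets s₀ domₐ
        mark-≡ : sets s markₐ ≡ sets s₀ markₐ
        out-⊆  : F₀ ⊆ sets s outₐ
        out-≤  : ∣ sets s outₐ ∣ ≤ ∣ F₀ ∣ + count s
        count≤ : count s ≤ k
        done   : ∀ x → toℕ x < l → p ~ x → x ~ q → x ∈ sets s outₐ ⊎ k ≤ count s
        avoid  : ∀ X → count s ≤ prefix l X ⊎ Between p q (sets s outₐ) X

    open Inv

    pass-step : ∀ v {s} → Inv (toℕ v) s → (p ~ v → v ~ q → k ≤ count s) → Inv (suc (toℕ v)) s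
    pass-step v {s} I skipped = record
      { dom-≡ = dom-≡ I ; mark-≡ = mark-≡ I ; out-⊆ = out-⊆ I ; out-≤ = out-≤ I ; count≤ = count≤ I
      ; done = λ x x<1+v → cases x (m<1+n⇒m<n∨m≡n x<1+v)
      ; avoid = λ X → bump X (avoid I X) }
      where
      cases : ∀ x → toℕ x < toℕ v ⊎ toℕ x ≡ toℕ v → p ~ x → x ~ q → x ∈ sets s outₐ ⊎ k ≤ count s
      cases x (inj₁ x<v) px xq = done I x x<v px xq
      cases x (inj₂ x≡v) px xq rewrite toℕ-injective x≡v = inj₂ (skipped px xq)
      bump : ∀ X → count s ≤ prefix (toℕ v) X ⊎ Between p q (sets s outₐ) X →
             count s ≤ prefix (suc (toℕ v)) X ⊎ Between p q (sets s outₐ) X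
      bump X (inj₁ c≤) = inj₁ (≤-trans c≤ (prefix-mono X v))
      bump X (inj₂ b)  = inj₂ b

    take-step : ∀ v {s} → Inv (toℕ v) s → p ~ v → v ~ q → count s < k →
      Inv (suc (toℕ v)) (store (sets (write outₐ v true s)) (suc (count s)))
    take-step v {s} I pv vq c<k = record
      { dom-≡ = dom-≡ I ; mark-≡ = mark-≡ I
      ; out-⊆ = insert-⊆ v ∘ out-⊆ I
      ; out-≤ = ≤-trans (∣insert∣≤ (sets s outₐ) v)
                  (≤-trans (s≤s (out-≤ I)) (≤-reflexive (sym (+-suc ∣ F₀ ∣ (count s)))))
      ; count≤ = c<k
      ; done = λ x x<1+v → cases x (m<1+n⇒m<n∨m≡n x<1+v)
      ; avoid = λ X → split X (v ∈? X) (avoid I X) }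
      where
      cases : ∀ x → toℕ x < toℕ v ⊎ toℕ x ≡ toℕ v → p ~ x → x ~ q →
              x ∈ sets s outₐ [ v ]← true ⊎ k ≤ suc (count s)
      cases x (inj₂ x≡v) px xq rewrite toℕ-injective x≡v = inj₁ (∈-insert v)
      cases x (inj₁ x<v) px xq with done I x x<v px xq
      ... | inj₁ x∈ = inj₁ (insert-⊆ v x∈)
      ... | inj₂ k≤ = inj₂ (m≤n⇒m≤1+n k≤)
      split : ∀ X → Dec (v ∈ X) → count s ≤ prefix (toℕ v) X ⊎ Between p q (sets s outₐ) X →
              suc (count s) ≤ prefix (suc (toℕ v)) X ⊎ Between p q (sets s outₐ [ v ]← true) X
      -- A new node outside `X` is itself the witness; one inside `X` raises both the counter and
      -- the prefix count of `X` by one.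
      split X (no v∉X)  _         = inj₂ (v , ∈-insert v , v∉X , pv , vq)
      split X (yes v∈X) (inj₁ c≤) = inj₁ (≤-trans (s≤s c≤) (≤-reflexive (sym (prefix-∈ v∈X))))
      split X (yes v∈X) (inj₂ b)  = inj₂ (Between-mono (insert-⊆ v) b)

    collected : Inv n (run (collect i j) ρ s₀)
    collected = loop-induction Inv _ step record
      { dom-≡ = refl ; mark-≡ = refl ; out-⊆ = id ; out-≤ = m≤m+n _ 0 ; count≤ = z≤n
      ; done = λ _ () ; avoid = λ _ → inj₁ z≤n }
      where
      step : ∀ v {s} → Inv (toℕ v) s → Inv (suc (toℕ v)) _
      step v {s} I = if-elim (Inv (suc (toℕ v))) _
        (λ pv → if-elim (Inv (suc (toℕ v))) _
          (λ vq → if-elim (Inv (suc (toℕ v))) _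
            (λ lt → take-step v I pv vq (<ᵇ-true lt))
            (λ ge → pass-step v I (λ _ _ → <ᵇ-false ge)))
          (λ ¬vq → pass-step v I (λ _ vq → contradiction (trans (sym vq) ¬vq) λ ())))
        (λ ¬pv → pass-step v I (λ pv → contradiction (trans (sym pv) ¬pv) λ ()))

    s₁ : Store n
    s₁ = run (collect i j) ρ s₀

    out-growth : ∣ sets s₁ outₐ ∣ ≤ ∣ F₀ ∣ + k
    out-growth = ≤-trans (out-≤ collected) (+-monoʳ-≤ ∣ F₀ ∣ (count≤ collected))

    -- If `x` was not collected, then `k` distinct nodes were, and `X` is too small to contain them
    -- all.
    joined : Joined p q (sets s₁ outₐ)
    joined X small {x} x∉X px xq with done collected x (toℕ<n x) px xq
    ... | inj₁ x∈F = x , x∈F , x∉X , px , xq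
    ... | inj₂ k≤c with avoid collected X
    ...   | inj₂ b  = b
    ...   | inj₁ c≤ = contradiction (≤-trans k≤c (subst (count s₁ ≤_) (prefix-all X) c≤)) (<⇒≱ small)

  module Matching {d} (i j : Fin d) (ρ : Vec (Fin n) d) (s₀ : Store n)
                  (fresh : ∀ v → v ∉ sets s₀ markₐ) where

    a b : Fin n
    a = lookup ρ i
    b = lookup ρ j

    -- `avoid` rests on the disjointness of the chosen pairs: either each of them meets `X`, which
    -- then has a separate marked element for every pair, or one of them is a detour. `reach`
    -- records that marks exist only if `b` is three `~`-steps away from `a`.
    record Inv (s : Store n) : Set where
      field
        dom-≡  : sets s domₐ ≡ sets s₀ domₐ
        out-≡  : sets s outₐ ≡ sets s₀ outₐ
        mark-≤ : ∣ sets s markₐ ∣ ≤ count s + count s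
        count≤ : count s ≤ k
        reach  : ∀ {v} → v ∈ sets s markₐ → Reach a b
        avoid  : ∀ X → count s ≤ ∣ X ∩ sets s markₐ ∣ ⊎ Detour a b (sets s markₐ) X

    open Inv

    -- Maximality of the greedy choice: a suitable pair of unmarked nodes can remain only when `k`
    -- pairs have been chosen. Marks and counter never decrease, so the property persists.
    Handled : Fin n → Fin n → Store n → Set
    Handled w w′ s = a ~ w → w ~ w′ → w′ ~ b →
      w ∈ sets s markₐ ⊎ w′ ∈ sets s markₐ ⊎ k ≤ count s

    record _≼_ (s s′ : Store n) : Set where
      field
        mark-⊆  : sets s markₐ ⊆ sets s′ markₐ
        count-≤ : count s ≤ count s′

    open _≼_

    ≼-refl : ∀ {s} → s ≼ s
    ≼-refl = record { mark-⊆ = id ; count-≤ = ≤-refl }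

    ≼-trans : ∀ {s s′ s″} → s ≼ s′ → s′ ≼ s″ → s ≼ s″
    ≼-trans p q = record { mark-⊆ = mark-⊆ q ∘ mark-⊆ p ; count-≤ = ≤-trans (count-≤ p) (count-≤ q) }

    Handled-mono : ∀ {w w′ s s′} → s ≼ s′ → Handled w w′ s → Handled w w′ s′
    Handled-mono s≼s′ H aw ww′ w′b with H aw ww′ w′b
    ... | inj₁ w∈         = inj₁ (mark-⊆ s≼s′ w∈)
    ... | inj₂ (inj₁ w′∈) = inj₂ (inj₁ (mark-⊆ s≼s′ w′∈))
    ... | inj₂ (inj₂ k≤)  = inj₂ (inj₂ (≤-trans k≤ (count-≤ s≼s′)))

    Step : Fin n → Fin n → Store n → Store n → Set
    Step w w′ s s′ = (Inv s′ × s ≼ s′) × Handled w w′ s′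

    take-step : ∀ w w′ {s} → Inv s → a ~ w → w ~ w′ → w′ ~ b →
      w ∉ sets s markₐ → w′ ∉ sets s markₐ → count s < k →
      Step w w′ s (store (sets (write markₐ w′ true (write markₐ w true s))) (suc (count s)))
    take-step w w′ {s} I aw ww′ w′b w∉M w′∉M c<k =
      ( record
        { dom-≡ = dom-≡ I ; out-≡ = out-≡ I
        ; mark-≤ = ≤-trans (∣insert∣≤ (M [ w ]← true) w′)
            (s≤s (≤-trans (∣insert∣≤ M w) (≤-trans (s≤s (mark-≤ I))
              (≤-reflexive (sym (+-suc (count s) (count s)))))))
        ; count≤ = c<k
        ; reach = λ _ → w , w′ , aw , ww′ , w′b
        ; avoid = λ X → split X (w ∈? X) (w′ ∈? X) (avoid I X) }
      , record { mark-⊆ = M⊆M′ ; count-≤ = n≤1+n _ } )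
      , λ _ _ _ → inj₁ w∈M′
      where
      M M′ : Subset n
      M = sets s markₐ
      M′ = M [ w ]← true [ w′ ]← true
      M⊆M′ : M ⊆ M′
      M⊆M′ = insert-⊆ w′ ∘ insert-⊆ w
      w∈M′ : w ∈ M′
      w∈M′ = insert-⊆ w′ (∈-insert w)
      w′∈M′ : w′ ∈ M′
      w′∈M′ = ∈-insert w′
      -- A member of `X` among the new marks was unmarked before, so the intersection grows
      -- strictly.
      hit : ∀ X {u} → u ∈ X → u ∈ M′ → u ∉ M → ∣ X ∩ M ∣ < ∣ X ∩ M′ ∣
      hit X u∈X u∈M′ u∉M = p⊂q⇒∣p∣<∣q∣
        ( (λ v∈ → let v∈X , v∈M = x∈p∩q⁻ X M v∈ in x∈p∩q⁺ (v∈X , M⊆M′ v∈M))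
        , _ , x∈p∩q⁺ (u∈X , u∈M′) , u∉M ∘ proj₂ ∘ x∈p∩q⁻ X M )
      split : ∀ X → Dec (w ∈ X) → Dec (w′ ∈ X) → count s ≤ ∣ X ∩ M ∣ ⊎ Detour a b M X →
              suc (count s) ≤ ∣ X ∩ M′ ∣ ⊎ Detour a b M′ X
      split X _         _          (inj₂ det) = inj₂ (Detour-mono M⊆M′ det)
      split X (yes w∈X) _          (inj₁ c≤)  = inj₁ (≤-<-trans c≤ (hit X w∈X w∈M′ w∉M))
      split X (no _)    (yes w′∈X) (inj₁ c≤)  = inj₁ (≤-<-trans c≤ (hit X w′∈X w′∈M′ w′∉M))
      split X (no w∉X)  (no w′∉X)  (inj₁ _)   =
        inj₂ (w , w′ , (w∈M′ , w′∈M′) , (w∉X , w′∉X) , aw , ww′ , w′b)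

    initial : Inv (run reset ρ s₀)
    initial = record
      { dom-≡ = refl ; out-≡ = refl ; mark-≤ = ≤-reflexive empty ; count≤ = z≤n
      ; reach = λ v∈ → contradiction v∈ (fresh _) ; avoid = λ _ → inj₁ z≤n }
      where
      empty : ∣ sets s₀ markₐ ∣ ≡ 0
      empty with ∣ sets s₀ markₐ ∣ in eq
      ... | zero  = refl
      ... | suc c with ∃∈∖ ∅ (sets s₀ markₐ)
                         (subst₂ _<_ (sym (∣⊥∣≡0 n)) (sym eq) (s≤s z≤n))
      ...   | v , v∈ , _ = contradiction v∈ (fresh v)

    matched : Inv (run (matching i j) ρ s₀) × (∀ w w′ → Handled w w′ (run (matching i j) ρ s₀))
    matched = loop-each Inv (λ w s → ∀ w′ → Handled w w′ s) _ outer initial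
      where
      -- `s₁` is the store at the start of the outer round; comparing with it carries the pairs of
      -- earlier rounds across the whole inner loop.
      inner : ∀ w → a ~ w → ∀ {s₁} w′ {s} → Inv s × s₁ ≼ s →
        let s′ = run (when close (suc zero) zero ⇒ when close zero (suc (suc j)) ⇒
                      when free markₐ (suc zero) ⇒ when free markₐ zero ⇒ when below kₚ ⇒
                      (put markₐ (suc zero) ⨾ put markₐ zero ⨾ inc)) (w′ ∷ w ∷ ρ) s in
        (Inv s′ × s₁ ≼ s′) × Handled w w′ s′ × (∀ v → Handled w v s → Handled w v s′)
      inner w aw w′ {s} (I , s₁≼s) =
        let (I′ , s≼s′) , H = core in (I′ , ≼-trans s₁≼s s≼s′) , H , λ v → Handled-mono s≼s′
        where
        pass : Handled w w′ s → Step w w′ s s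
        pass H = (I , ≼-refl) , H
        core : Step w w′ s _
        core = if-elim (Step w w′ s) _
          (λ ww′ → if-elim (Step w w′ s) _
            (λ w′b → if-elim (Step w w′ s) _
              (λ w∉ → if-elim (Step w w′ s) _
                (λ w′∉ → if-elim (Step w w′ s) _
                  (λ lt → take-step w w′ I aw ww′ w′b (lookup⇒∉ (not-true w∉)) (lookup⇒∉ (not-true w′∉)) (<ᵇ-true lt))
                  (λ ge → pass λ _ _ _ → inj₂ (inj₂ (<ᵇ-false ge))))
                (λ w′∈ → pass λ _ _ _ → inj₂ (inj₁ (lookup⇒[]= w′ _ (not-false w′∈)))))
              (λ w∈ → pass λ _ _ _ → inj₁ (lookup⇒[]= w _ (not-false w∈))))
            (λ ¬w′b → pass λ _ _ w′b → contradiction (trans (sym w′b) ¬w′b) λ ()))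
          (λ ¬ww′ → pass λ _ ww′ → contradiction (trans (sym ww′) ¬ww′) λ ())
      outer : ∀ w {s} → Inv s →
        let s′ = _ in
        Inv s′ × (∀ w′ → Handled w w′ s′) × (∀ v → (∀ w′ → Handled v w′ s) → (∀ w′ → Handled v w′ s′))
      outer w {s} I = if-elim
        (λ s′ → Inv s′ × (∀ w′ → Handled w w′ s′) × (∀ v → (∀ w′ → Handled v w′ s) → (∀ w′ → Handled v w′ s′)))
        _
        (λ aw → let (I′ , s≼s′) , H = loop-each (λ s′ → Inv s′ × s ≼ s′) (Handled w) _ (inner w aw) (I , ≼-refl)
                in I′ , H , λ v Hv w′ → Handled-mono s≼s′ (Hv w′))
        (λ ¬aw → I , (λ w′ aw → contradiction (trans (sym aw) ¬aw) λ ()) , λ _ → id)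

  module Expand {d} (i j : Fin d) (ρ : Vec (Fin n) d) (s₀ : Store n) where

    a b : Fin n
    a = lookup ρ i
    b = lookup ρ j

    M₀ : Subset n
    M₀ = sets s₀ markₐ

    record Inv (s : Store n) : Set where
      field
        dom-≡  : sets s domₐ ≡ sets s₀ domₐ
        mark-≡ : sets s markₐ ≡ M₀
        out-⊆  : sets s₀ outₐ ⊆ sets s outₐ

    open Inv

    Expanded : Fin n → Subset n → Set
    Expanded p F = p ∈ M₀ → p ∈ F × Joined p b F × Joined p a F

    Expanded-mono : ∀ {p F F′} → F ⊆ F′ → Expanded p F → Expanded p F′
    Expanded-mono F⊆F′ E p∈M = let p∈F , Jb , Ja = E p∈M in
      F⊆F′ p∈F , Joined-mono F⊆F′ Jb , Joined-mono F⊆F′ Ja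

    body : Cmd (suc d)
    body = put outₐ zero ⨾ collect zero (suc j) ⨾ collect zero (suc i)

    Step : Fin n → Store n → Store n → Set
    Step p s s′ = Inv s′ × Expanded p (sets s′ outₐ) × sets s outₐ ⊆ sets s′ outₐ ×
      ∣ sets s′ outₐ ∣ ≤ ∣ sets s outₐ ∣ + 𝟙 (lookup M₀ p) * (1 + (k + k))

    step : ∀ p {s} → Inv s → Step p s (run (when member markₐ zero ⇒ body) (p ∷ ρ) s)
    -- After the rewrite the test reads the marks from before the loop, so its outcome is the
    -- indicator in the growth bound.
    step p {s} I rewrite mark-≡ I = if-elim (Step p s) (lookup M₀ p)
      (λ p∈M → subst (λ x → Step′ x (run body (p ∷ ρ) s)) (sym p∈M) taken)
      (λ p∉M → I , (λ p∈M → contradiction p∈M (lookup⇒∉ p∉M)) , id , m≤m+n _ _)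
      where
      Step′ : Bool → Store n → Set
      Step′ x s′ = Inv s′ × Expanded p (sets s′ outₐ) × sets s outₐ ⊆ sets s′ outₐ ×
        ∣ sets s′ outₐ ∣ ≤ ∣ sets s outₐ ∣ + 𝟙 x * (1 + (k + k))
      s¹ = write outₐ p true s
      module C₁ = Collect zero (suc j) (p ∷ ρ) s¹
      module C₂ = Collect zero (suc i) (p ∷ ρ) C₁.s₁
      module I₁ = C₁.Inv C₁.collected
      module I₂ = C₂.Inv C₂.collected
      taken : Step′ true (run body (p ∷ ρ) s)
      taken = record { dom-≡ = trans I₂.dom-≡ (trans I₁.dom-≡ (dom-≡ I))
                     ; mark-≡ = trans I₂.mark-≡ (trans I₁.mark-≡ (mark-≡ I))
                     ; out-⊆ = I₂.out-⊆ ∘ I₁.out-⊆ ∘ insert-⊆ p ∘ out-⊆ I }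
            , (λ _ → I₂.out-⊆ (I₁.out-⊆ (∈-insert p)) , Joined-mono I₂.out-⊆ C₁.joined , C₂.joined)
            , I₂.out-⊆ ∘ I₁.out-⊆ ∘ insert-⊆ p
            , (begin
                ∣ sets C₂.s₁ outₐ ∣        ≤⟨ C₂.out-growth ⟩
                ∣ sets C₁.s₁ outₐ ∣ + k    ≤⟨ +-monoˡ-≤ k C₁.out-growth ⟩
                ∣ sets s¹ outₐ ∣ + k + k   ≤⟨ +-monoˡ-≤ k (+-monoˡ-≤ k (∣insert∣≤ (sets s outₐ) p)) ⟩
                1 + f + k + k
                  ≡⟨ solve 2 (λ f k → con 1 :+ f :+ k :+ k := f :+ con 1 :* (con 1 :+ (k :+ k))) refl f k ⟩
                f + 1 * (1 + (k + k))      ∎)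
        where
        open ≤-Reasoning
        open +-*-Solver
        f = ∣ sets s outₐ ∣

    start : Inv s₀
    start = record { dom-≡ = refl ; mark-≡ = refl ; out-⊆ = id }

    s₁ : Store n
    s₁ = run (expand i j) ρ s₀

    expanded : Inv s₁ × (∀ p → Expanded p (sets s₁ outₐ))
    expanded = loop-each Inv (λ p s → Expanded p (sets s outₐ)) _
      (λ p I → let I′ , E , F⊆F′ , _ = step p I in I′ , E , λ p → Expanded-mono F⊆F′) start

    out-growth : ∣ sets s₁ outₐ ∣ ≤ ∣ sets s₀ outₐ ∣ + ∣ M₀ ∣ * (1 + (k + k))
    out-growth = subst (λ x → ∣ sets s₁ outₐ ∣ ≤ ∣ sets s₀ outₐ ∣ + x) (sum-member M₀ (1 + (k + k)))
      (loop-growth Inv (λ s → ∣ sets s outₐ ∣) _ _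
        (λ p I → let I′ , _ , _ , growth = step p I in I′ , growth) start)

  -- At most 2k marked nodes for a pair of ends, each contributing itself and two collections of at
  -- most `k` nodes.
  linkCost : ℕ
  linkCost = (k + k) * (1 + (k + k))

  module Link {d} (i j : Fin d) (ρ : Vec (Fin n) d) (s₀ : Store n) where

    a b : Fin n
    a = lookup ρ i
    b = lookup ρ j

    cleared : (sets (run (each (drop markₐ zero)) ρ s₀) domₐ ≡ sets s₀ domₐ ×
               sets (run (each (drop markₐ zero)) ρ s₀) outₐ ≡ sets s₀ outₐ) ×
              (∀ v → v ∉ sets (run (each (drop markₐ zero)) ρ s₀) markₐ)
    cleared = loop-each (λ s → sets s domₐ ≡ sets s₀ domₐ × sets s outₐ ≡ sets s₀ outₐ)
      (λ v s → v ∉ sets s markₐ) _ (λ v I → I , ∉-delete v , λ u u∉ → u∉ ∘ ∈-delete⁻) (refl , refl)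

    s¹ s² s³ : Store n
    s¹ = run (each (drop markₐ zero)) ρ s₀
    s² = run (matching i j) ρ s¹
    s³ = run (expand i j) ρ s²

    module M = Matching i j ρ s¹ (proj₂ cleared)
    module E = Expand i j ρ s²
    module IM = M.Inv (proj₁ M.matched)
    module IE = E.Inv (proj₁ E.expanded)

    dom-≡ : sets s³ domₐ ≡ sets s₀ domₐ
    dom-≡ = trans IE.dom-≡ (trans IM.dom-≡ (proj₁ (proj₁ cleared)))

    out²-≡ : sets s² outₐ ≡ sets s₀ outₐ
    out²-≡ = trans IM.out-≡ (proj₂ (proj₁ cleared))

    out-⊆ : sets s₀ outₐ ⊆ sets s³ outₐ
    out-⊆ = IE.out-⊆ ∘ subst (_ ∈_) (sym out²-≡)

    mark⊆out : sets s² markₐ ⊆ sets s³ outₐ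
    mark⊆out {p} p∈M = proj₁ (proj₂ E.expanded p p∈M)

    -- If `w` is marked, it is kept and `w′` is replaced by a collected node between `w` and `b`; if
    -- `w′` is marked, the same is done from the other end. Otherwise `k` disjoint pairs were
    -- chosen, and `X` misses one of them.
    linked : Linked a b (sets s³ outₐ)
    linked X small {w} {w′} w∉X w′∉X aw ww′ w′b with proj₂ M.matched w w′ aw ww′ w′b
    ... | inj₁ w∈M =
      let w∈F , Jb , _ = proj₂ E.expanded w w∈M
          x , x∈F , x∉X , wx , xb = Jb X small w′∉X ww′ w′b
      in w , x , (w∈F , x∈F) , (w∉X , x∉X) , aw , wx , xb
    ... | inj₂ (inj₁ w′∈M) =
      let w′∈F , _ , Ja = proj₂ E.expanded w′ w′∈M
          x , x∈F , x∉X , w′x , xa = Ja X small w∉X (~-sym ww′) (~-sym aw)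
      in x , w′ , (x∈F , w′∈F) , (x∉X , w′∉X) , ~-sym xa , ~-sym w′x , w′b
    ... | inj₂ (inj₂ k≤c) with IM.avoid X
    ...   | inj₁ c≤ = contradiction (≤-trans k≤c (≤-trans c≤ (∣p∩q∣≤∣p∣ X _))) (<⇒≱ small)
    ...   | inj₂ det = Detour-mono mark⊆out det

    -- Any mark witnesses that `b` is reachable from `a`, so for `b` outside `R` there are no marks
    -- and the indicator can be 0.
    mark-≤ : ∀ {R} → (Reach a b → b ∈ R) → ∣ sets s² markₐ ∣ ≤ 𝟙 (lookup R b) * (k + k)
    mark-≤ {R} near with ∣ sets s² markₐ ∣ in eq
    ... | zero  = z≤n
    ... | suc c with ∃∈∖ ∅ (sets s² markₐ)
                       (subst₂ _<_ (sym (∣⊥∣≡0 n)) (sym eq) (s≤s z≤n))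
    ...   | v , v∈M , _ rewrite ∈⇒𝟙≡1 {S = R} (near (IM.reach v∈M)) | sym eq | *-identityˡ (k + k) =
      ≤-trans IM.mark-≤ (+-mono-≤ IM.count≤ IM.count≤)

    out-growth : ∀ {R} → (Reach a b → b ∈ R) →
      ∣ sets s³ outₐ ∣ ≤ ∣ sets s₀ outₐ ∣ + 𝟙 (lookup R b) * linkCost
    out-growth {R} near = begin
      ∣ sets s³ outₐ ∣
        ≤⟨ E.out-growth ⟩
      ∣ sets s² outₐ ∣ + ∣ sets s² markₐ ∣ * (1 + (k + k))
        ≤⟨ +-mono-≤ (≤-reflexive (cong ∣_∣ out²-≡)) (*-monoˡ-≤ (1 + (k + k)) (mark-≤ near)) ⟩
      ∣ sets s₀ outₐ ∣ + 𝟙 (lookup R b) * (k + k) * (1 + (k + k))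
        ≡⟨ cong (λ x → ∣ sets s₀ outₐ ∣ + x) (*-assoc (𝟙 (lookup R b)) (k + k) _) ⟩
      ∣ sets s₀ outₐ ∣ + 𝟙 (lookup R b) * linkCost ∎
      where open ≤-Reasoning

  module LinkAll (s₀ : Store n) where

    D₀ : Subset n
    D₀ = sets s₀ domₐ

    s₁ : Store n
    s₁ = run linkAll [] s₀

    record Inv (s : Store n) : Set where
      field
        dom-≡ : sets s domₐ ≡ D₀
        out-⊆ : sets s₀ outₐ ⊆ sets s outₐ

    open Inv

    Done : Fin n → Fin n → Subset n → Set
    Done a b F = a ∈ D₀ → b ∈ D₀ → Linked a b F

    Done-mono : ∀ {a b F F′} → F ⊆ F′ → Done a b F → Done a b F′
    Done-mono F⊆F′ L a∈ b∈ = Linked-mono F⊆F′ (L a∈ b∈)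

    innerBody : Cmd 2
    innerBody = when member domₐ zero ⇒ link (suc zero) zero

    -- `R` stands for any region containing what `a` reaches. Ends `b` outside it add nothing, so
    -- summing over `b` charges only `R ∩ D₀`.
    InnerStep : Fin n → Fin n → Store n → Store n → Set
    InnerStep a b s s′ = Inv s′ × sets s outₐ ⊆ sets s′ outₐ × Done a b (sets s′ outₐ) ×
      (∀ R → (Reach a b → b ∈ R) →
        ∣ sets s′ outₐ ∣ ≤ ∣ sets s outₐ ∣ + 𝟙 (lookup (R ∩ D₀) b) * linkCost)

    inner : ∀ a b {s} → Inv s → InnerStep a b s (run innerBody (b ∷ a ∷ []) s)
    inner a b {s} I rewrite dom-≡ I = if-elim (InnerStep a b s) (lookup D₀ b)
      (λ b∈D → record { dom-≡ = trans L.dom-≡ (dom-≡ I) ; out-⊆ = L.out-⊆ ∘ out-⊆ I }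
             , L.out-⊆ , (λ _ _ → L.linked)
             , λ R near → L.out-growth λ r → x∈p∩q⁺ (near r , lookup⇒[]= b D₀ b∈D))
      (λ b∉D → I , id , (λ _ b∈D → contradiction b∈D (lookup⇒∉ b∉D)) , λ _ _ → m≤m+n _ _)
      where module L = Link (suc zero) zero (b ∷ a ∷ []) s

    outerBody : Cmd 1
    outerBody = when member domₐ zero ⇒ each innerBody

    OuterStep : Fin n → Store n → Store n → Set
    OuterStep a s s′ = Inv s′ × sets s outₐ ⊆ sets s′ outₐ × (∀ b → Done a b (sets s′ outₐ)) ×
      (∀ R → (∀ b → Reach a b → b ∈ R) →
        ∣ sets s′ outₐ ∣ ≤ ∣ sets s outₐ ∣ + 𝟙 (lookup D₀ a) * (∣ R ∩ D₀ ∣ * linkCost))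

    outer : ∀ a {s} → Inv s → OuterStep a s (run outerBody (a ∷ []) s)
    outer a {s} I with lookup (sets s domₐ) a in eq
    ... | false = I , id , (λ b a∈D → contradiction a∈D (subst (a ∉_) (dom-≡ I) (lookup⇒∉ eq))) , λ _ _ → m≤m+n _ _
    ... | true  = I′ , F⊆F′ , done , λ R near →
      subst (λ x → _ ≤ ∣ sets s outₐ ∣ + x)
        (trans (sum-member (R ∩ D₀) linkCost) (trans (sym (*-identityˡ _))
          (cong (_* (∣ R ∩ D₀ ∣ * linkCost)) (sym (∈⇒𝟙≡1 {S = D₀} a∈D)))))
        (loop-growth Inv (λ s → ∣ sets s outₐ ∣) _ _
          (λ b I → let I′ , _ , _ , growth = inner a b I in I′ , growth R (near b)) I)
      where
      a∈D : a ∈ D₀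
      a∈D = subst (a ∈_) (dom-≡ I) (lookup⇒[]= a _ eq)
      all = loop-each (λ s′ → Inv s′ × sets s outₐ ⊆ sets s′ outₐ) (λ b s′ → Done a b (sets s′ outₐ)) _
        (λ b (I , F⊆) → let I′ , ⊆′ , D , _ = inner a b I in
           (I′ , ⊆′ ∘ F⊆) , D , λ _ → Done-mono ⊆′) {s} (I , id)
      I′ = proj₁ (proj₁ all)
      F⊆F′ = proj₂ (proj₁ all)
      done = proj₂ all

    start : Inv s₀
    start = record { dom-≡ = refl ; out-⊆ = id }

    all-linked : Inv s₁ × (∀ a b → Done a b (sets s₁ outₐ))
    all-linked = loop-each Inv (λ a s → ∀ b → Done a b (sets s outₐ)) _
      (λ a I → let I′ , ⊆′ , D , _ = outer a I in I′ , D , λ _ D b → Done-mono ⊆′ (D b)) start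

    out-growth : ∀ (R : Fin n → Subset n) c → (∀ a b → Reach a b → b ∈ R a) → (∀ a → ∣ R a ∩ D₀ ∣ ≤ c) →
      ∣ sets s₁ outₐ ∣ ≤ ∣ sets s₀ outₐ ∣ + ∣ D₀ ∣ * (c * linkCost)
    out-growth R c near few = subst (λ x → _ ≤ ∣ sets s₀ outₐ ∣ + x) (sum-member D₀ (c * linkCost))
      (loop-growth Inv (λ s → ∣ sets s outₐ ∣) _ _
        (λ a I → let I′ , _ , _ , growth = outer a I in
          I′ , ≤-trans (growth (R a) (near a))
            (+-monoʳ-≤ _ (*-monoʳ-≤ (𝟙 (lookup D₀ a)) (*-monoˡ-≤ linkCost (few a))))) start)

  module Grow (p : Param) (s₀ : Store n) where

    thr : ℕ
    thr = param G k m p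

    s₁ : Store n
    s₁ = run (grow p) [] s₀

    countLoop : Cmd 1
    countLoop = each (when member domₐ zero ⇒ when edge (suc zero) zero ⇒ inc)

    counted : ∀ v s → let s′ = run countLoop (v ∷ []) (run reset (v ∷ []) s) in
      sets s′ ≡ sets s × count s′ ≡ ∣ neighbours G v ∩ sets s domₐ ∣
    counted v s = let S≡ , c≡ = loop-induction Inv _ step (refl , refl) in
      S≡ , trans c≡ (prefix-all N)
      where
      N : Subset n
      N = neighbours G v ∩ sets s domₐ
      Inv : ℕ → Store n → Set
      Inv l s′ = sets s′ ≡ sets s × count s′ ≡ prefix l N
      pass : ∀ x {s′} → Inv (toℕ x) s′ → x ∉ N → Inv (suc (toℕ x)) s′
      pass x (S≡ , c≡) x∉N = S≡ , trans c≡ (sym (prefix-∉ x∉N))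
      step : ∀ x {s′} → Inv (toℕ x) s′ → Inv (suc (toℕ x)) _
      step x {s′} I@(refl , c≡) = if-elim (Inv (suc (toℕ x))) (lookup (sets s′ domₐ) x)
        (λ x∈ → if-elim (Inv (suc (toℕ x))) (adj G v x)
          (λ vx → refl , trans (cong suc c≡) (sym (prefix-∈ (x∈p∩q⁺ (∈-neighbours⁺ G vx , lookup⇒[]= x _ x∈)))))
          (λ ¬vx → pass x I λ x∈N → contradiction
            (trans (sym (∈-neighbours⁻ G (proj₁ (x∈p∩q⁻ (neighbours G v) _ x∈N)))) ¬vx) λ ()))
        (λ x∉ → pass x I (lookup⇒∉ x∉ ∘ proj₂ ∘ x∈p∩q⁻ (neighbours G v) _))

    -- Everything is relative to the starting store because the pass runs twice: from empty sets
    -- with threshold `k`, then from the k-dominating set with threshold `m`.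
    record Inv (s : Store n) : Set where
      field
        dom-⊆  : sets s₀ domₐ ⊆ sets s domₐ
        out-⊆  : sets s₀ outₐ ⊆ sets s outₐ
        within : ∀ {v} → v ∈ sets s outₐ → v ∈ sets s₀ outₐ ⊎ v ∈ sets s domₐ
        shadow : sets s₀ domₐ ⊆ sets s₀ outₐ → sets s domₐ ⊆ sets s outₐ
        sparse : ∀ Q → Complete G Q → ∣ Q ∩ sets s₀ domₐ ∣ ≤ thr → ∣ Q ∩ sets s domₐ ∣ ≤ thr

    Dominated : Fin n → Subset n → Set
    Dominated v D = v ∈ D ⊎ thr ≤ ∣ neighbours G v ∩ D ∣

    Dominated-mono : ∀ {v D D′} → D ⊆ D′ → Dominated v D → Dominated v D′
    Dominated-mono         D⊆D′ (inj₁ v∈) = inj₁ (D⊆D′ v∈)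
    Dominated-mono {v} {D} D⊆D′ (inj₂ t≤) = inj₂ (≤-trans t≤ (p⊆q⇒∣p∣≤∣q∣ λ x∈ →
      let x∈N , x∈D = x∈p∩q⁻ (neighbours G v) D x∈ in x∈p∩q⁺ (x∈N , D⊆D′ x∈D)))

    -- For `v` in the clique `Q`, all other members of `Q` are neighbours of `v`; fewer than `thr`
    -- of them were kept, so `v` brings the count to at most `thr`. For `v` outside `Q` the count
    -- does not change.
    insert-sparse : ∀ Q D v → Complete G Q → ∣ neighbours G v ∩ D ∣ < thr →
      ∣ Q ∩ D ∣ ≤ thr → ∣ Q ∩ (D [ v ]← true) ∣ ≤ thr
    insert-sparse Q D v clique lt old with v ∈? Q
    ... | no v∉Q = ≤-trans (p⊆q⇒∣p∣≤∣q∣ sub) old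
      where
      sub : Q ∩ (D [ v ]← true) ⊆ Q ∩ D
      sub u∈ with x∈p∩q⁻ Q _ u∈
      ... | u∈Q , u∈D′ with ∈-insert⁻ u∈D′
      ...   | inj₁ u∈D  = x∈p∩q⁺ (u∈Q , u∈D)
      ...   | inj₂ refl = contradiction u∈Q v∉Q
    ... | yes v∈Q = ≤-trans (p⊆q⇒∣p∣≤∣q∣ sub) (≤-trans (∣insert∣≤ (neighbours G v ∩ D) v) lt)
      where
      sub : Q ∩ (D [ v ]← true) ⊆ (neighbours G v ∩ D) [ v ]← true
      sub {u} u∈ with x∈p∩q⁻ Q _ u∈
      ... | u∈Q , u∈D′ with u ≟ v | ∈-insert⁻ u∈D′
      ...   | yes refl | _        = ∈-insert v
      ...   | no  u≢v  | inj₂ u≡v = contradiction u≡v u≢v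
      ...   | no  u≢v  | inj₁ u∈D =
        insert-⊆ v (x∈p∩q⁺ (∈-neighbours⁺ G (clique v u v∈Q u∈Q (u≢v ∘ sym)) , u∈D))

    Step : Fin n → Store n → Store n → Set
    Step v s s′ = Inv s′ × Dominated v (sets s′ domₐ) × sets s domₐ ⊆ sets s′ domₐ

    step : ∀ v {s} → Inv s → Step v s
      (run (reset ⨾ countLoop ⨾ when below p ⇒ (put domₐ zero ⨾ put outₐ zero)) (v ∷ []) s)
    step v {s} I with run countLoop (v ∷ []) (run reset (v ∷ []) s) | counted v s
    ... | store S c | refl , refl = if-elim (Step v s) (∣ neighbours G v ∩ S domₐ ∣ <ᵇ thr)
      (λ lt → record
        { dom-⊆ = insert-⊆ v ∘ Inv.dom-⊆ I
        ; out-⊆ = insert-⊆ v ∘ Inv.out-⊆ I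
        ; within = within′ ∘ ∈-insert⁻
        ; shadow = λ h → shadow′ h ∘ ∈-insert⁻
        ; sparse = λ Q clique base → insert-sparse Q (S domₐ) v clique (<ᵇ-true lt) (Inv.sparse I Q clique base)
        } , inj₁ (∈-insert v) , insert-⊆ v)
      (λ ge → record { Inv I } , inj₂ (<ᵇ-false ge) , id)
      where
      within′ : ∀ {u} → u ∈ S outₐ ⊎ u ≡ v → u ∈ sets s₀ outₐ ⊎ u ∈ S domₐ [ v ]← true
      within′ (inj₂ refl) = inj₂ (∈-insert v)
      within′ (inj₁ u∈) with Inv.within I u∈
      ... | inj₁ u∈₀ = inj₁ u∈₀
      ... | inj₂ u∈D = inj₂ (insert-⊆ v u∈D)
      shadow′ : sets s₀ domₐ ⊆ sets s₀ outₐ → ∀ {u} → u ∈ S domₐ ⊎ u ≡ v → u ∈ S outₐ [ v ]← true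
      shadow′ h (inj₂ refl) = ∈-insert v
      shadow′ h (inj₁ u∈D)  = insert-⊆ v (Inv.shadow I h u∈D)

    grown : Inv s₁ × (∀ v → Dominated v (sets s₁ domₐ))
    grown = loop-each Inv (λ v s → Dominated v (sets s domₐ)) _
      (λ v I → let I′ , D , D⊆D′ = step v I in I′ , D , λ _ → Dominated-mono D⊆D′)
      record { dom-⊆ = id ; out-⊆ = id ; within = inj₁ ; shadow = id ; sparse = λ _ _ → id }

    dominating : MDominating G thr (sets s₁ domₐ)
    dominating v v∉D with proj₂ grown v
    ... | inj₁ v∈D = contradiction v∈D v∉D
    ... | inj₂ t≤  = t≤

-- Geometry of unit disk graphs

-- The rational z / 8: the second argument of `mkℚᵘ` is the denominator minus one. In particular
-- `grid (+ 4)` is 1/2 and `grid (+ 16)` is 2.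
grid : ℤ → ℚ
grid z = fromℚᵘ (ℚᵘ.mkℚᵘ z 7)

grid-+ : ∀ y z → grid (y ℤ.+ z) ≡ grid y ℚ.+ grid z
grid-+ y z = ℚₚ.toℚᵘ-injective (begin
  toℚᵘ (grid (y ℤ.+ z))                     ≈⟨ ℚₚ.toℚᵘ-fromℚᵘ (ℚᵘ.mkℚᵘ (y ℤ.+ z) 7) ⟩
  ℚᵘ.mkℚᵘ (y ℤ.+ z) 7
    ≈⟨ ℚᵘ.*≡* (solve 2 (λ y z → (y :+ z) :* con (+ 64)
        := (y :* con (+ 8) :+ z :* con (+ 8)) :* con (+ 8)) refl y z) ⟩
  ℚᵘ.mkℚᵘ y 7 ℚᵘ.+ ℚᵘ.mkℚᵘ z 7              ≈⟨ ℚᵘₚ.+-cong (ℚₚ.toℚᵘ-fromℚᵘ (ℚᵘ.mkℚᵘ y 7)) (ℚₚ.toℚᵘ-fromℚᵘ (ℚᵘ.mkℚᵘ z 7)) ⟨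
  toℚᵘ (grid y) ℚᵘ.+ toℚᵘ (grid z)          ≈⟨ ℚₚ.toℚᵘ-homo-+ (grid y) (grid z) ⟨
  toℚᵘ (grid y ℚ.+ grid z)                  ∎)
  where
  open ℤS.+-*-Solver
  open import Relation.Binary.Reasoning.Setoid ℚᵘₚ.≃-setoid

grid-cancel-≤ : ∀ {y z} → grid y ℚ.≤ grid z → y ℤ.≤ z
grid-cancel-≤ {y} {z} y≤z with ℚᵘₚ.≤-respˡ-≃ (ℚₚ.toℚᵘ-fromℚᵘ (ℚᵘ.mkℚᵘ y 7))
                               (ℚᵘₚ.≤-respʳ-≃ (ℚₚ.toℚᵘ-fromℚᵘ (ℚᵘ.mkℚᵘ z 7)) (ℚₚ.toℚᵘ-mono-≤ y≤z))
... | ℚᵘ.*≤* y8≤z8 = ℤₚ.*-cancelʳ-≤-pos y z (+ 8) y8≤z8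

⌊_⌋₈ : ℚ → ℤ
⌊ q ⌋₈ = (ℚ.↥ q ℤ.* + 8) ℤ./ℕ ℚ.↧ₙ q

grid-floor-≤ : ∀ q → grid ⌊ q ⌋₈ ℚ.≤ q
grid-floor-≤ q@record{} = ℚₚ.toℚᵘ-cancel-≤
  (ℚᵘₚ.≤-respˡ-≃ (ℚᵘₚ.≃-sym (ℚₚ.toℚᵘ-fromℚᵘ (ℚᵘ.mkℚᵘ ⌊ q ⌋₈ 7)))
    (ℚᵘ.*≤* (ℤDM.[n/ℕd]*d≤n (ℚ.↥ q ℤ.* + 8) (ℚ.↧ₙ q))))

≤-grid-floor : ∀ q → q ℚ.≤ grid (+ 1 ℤ.+ ⌊ q ⌋₈)
≤-grid-floor q@record{} = ℚₚ.toℚᵘ-cancel-≤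
  (ℚᵘₚ.≤-respʳ-≃ (ℚᵘₚ.≃-sym (ℚₚ.toℚᵘ-fromℚᵘ (ℚᵘ.mkℚᵘ (+ 1 ℤ.+ ⌊ q ⌋₈) 7)))
    (ℚᵘ.*≤* (ℤₚ.<⇒≤ (ℤDM.n<s[n/ℕd]*d (ℚ.↥ q ℤ.* + 8) (ℚ.↧ₙ q)))))

p≤∣p∣ : ∀ p → p ℚ.≤ ℚ.∣ p ∣
p≤∣p∣ p with ℚₚ.≤-total 0ℚ p
... | inj₁ 0≤p = ℚₚ.≤-reflexive (sym (ℚₚ.0≤p⇒∣p∣≡p 0≤p))
... | inj₂ p≤0 = ℚₚ.≤-trans p≤0 (ℚₚ.0≤∣p∣ p)

p-q+q≡p : ∀ p q → (p ℚ.- q) ℚ.+ q ≡ p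
p-q+q≡p = solve 2 (λ p q → (p :+ :- q) :+ q := p) refl
  where open ℚS.+-*-Solver

p+q-q≡p : ∀ p q → (p ℚ.+ q) ℚ.- q ≡ p
p+q-q≡p = solve 2 (λ p q → (p :+ q) :+ :- q := p) refl
  where open ℚS.+-*-Solver

≤+⇒-≤ : ∀ {p q r} → p ℚ.≤ r ℚ.+ q → p ℚ.- q ℚ.≤ r
≤+⇒-≤ {p} {q} {r} h = subst (p ℚ.- q ℚ.≤_) (p+q-q≡p r q) (ℚₚ.+-monoˡ-≤ (ℚ.- q) h)

-≤⇒≤+ : ∀ {p q r} → p ℚ.- q ℚ.≤ r → p ℚ.≤ r ℚ.+ q
-≤⇒≤+ {p} {q} {r} h = subst (ℚ._≤ r ℚ.+ q) (p-q+q≡p p q) (ℚₚ.+-monoˡ-≤ q h)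

∣p∣²≡p² : ∀ p → ℚ.∣ p ∣ ℚ.* ℚ.∣ p ∣ ≡ p ℚ.* p
∣p∣²≡p² p with ℚₚ.∣p∣≡p∨∣p∣≡-p p
... | inj₁ eq rewrite eq = refl
... | inj₂ eq rewrite eq = solve 1 (λ p → (:- p) :* (:- p) := p :* p) refl p
  where open ℚS.+-*-Solver

*-mono-≤₀ : ∀ {p q} → 0ℚ ℚ.≤ p → p ℚ.≤ q → p ℚ.* p ℚ.≤ q ℚ.* q
*-mono-≤₀ {p} {q} 0≤p p≤q = ℚₚ.≤-trans
  (ℚₚ.*-monoʳ-≤-nonNeg p {{ℚ.nonNegative 0≤p}} p≤q)
  (ℚₚ.*-monoˡ-≤-nonNeg q {{ℚ.nonNegative (ℚₚ.≤-trans 0≤p p≤q)}} p≤q)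

0≤p² : ∀ p → 0ℚ ℚ.≤ p ℚ.* p
0≤p² p = subst (0ℚ ℚ.≤_) (∣p∣²≡p² p)
  (*-mono-≤₀ {0ℚ} {ℚ.∣ p ∣} ℚₚ.≤-refl (ℚₚ.0≤∣p∣ p))

-- 9/64 is below 1/2, so two such squares sum to at most 1, as adjacency within a cell requires.
small-square : ∀ p → p ℚ.≤ grid (+ 3) → ℚ.- p ℚ.≤ grid (+ 3) → p ℚ.* p ℚ.≤ grid (+ 4)
small-square p p≤ -p≤ = subst (ℚ._≤ grid (+ 4)) (∣p∣²≡p² p)
  (ℚₚ.≤-trans (*-mono-≤₀ (ℚₚ.0≤∣p∣ p) ∣p∣≤) (from-yes (grid (+ 3) ℚ.* grid (+ 3) ℚ.≤? grid (+ 4))))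
  where
  ∣p∣≤ : ℚ.∣ p ∣ ℚ.≤ grid (+ 3)
  ∣p∣≤ with ℚₚ.∣p∣≡p∨∣p∣≡-p p
  ... | inj₁ eq = subst (ℚ._≤ grid (+ 3)) (sym eq) p≤
  ... | inj₂ eq = subst (ℚ._≤ grid (+ 3)) (sym eq) -p≤

-- Above 2 the square would be at least 4, against the bound 2; a comparison of rationals replaces a
-- square root.
bounded-square : ∀ p r → p ℚ.* p ℚ.≤ r → r ℚ.≤ grid (+ 16) → p ℚ.≤ grid (+ 16)
bounded-square p r p²≤r r≤2 with p ℚ.≤? grid (+ 16)
... | yes p≤2 = p≤2
... | no  p≰2 = contradiction
  (ℚₚ.≤-trans (*-mono-≤₀ (from-yes (0ℚ ℚ.≤? grid (+ 16))) (ℚₚ.<⇒≤ (ℚₚ.≰⇒> p≰2))) (ℚₚ.≤-trans p²≤r r≤2))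
  (from-no (grid (+ 16) ℚ.* grid (+ 16) ℚ.≤? grid (+ 16)))

-- z / 8 approximates x, with slack for the rounding and for the tail of x.
record Approximates (z : ℤ) (x : ℝ) : Set where
  constructor from_bounded_
  field
    start  : ℕ
    bounds : ∀ i → start ≤ i →
      grid z ℚ.≤ grid (+ 1) ℚ.+ seq x i × seq x i ℚ.≤ grid (+ 2 ℤ.+ z)

-- Take a term from which on the sequence moves by at most 1/8 and round it down to the grid:
-- rounding and tail each cost at most one grid unit.
approximate : ∀ x → ∃[ z ] Approximates z x
approximate x with cauchy x (grid (+ 1)) (from-yes (0ℚ ℚ.<? grid (+ 1)))
... | N , settled = ⌊ q ⌋₈ , from N bounded λ i N≤i →
    ℚₚ.≤-trans (grid-floor-≤ q) (-≤⇒≤+ (ℚₚ.≤-trans (p≤∣p∣ _) (settled N i ≤-refl N≤i)))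
  , ℚₚ.≤-trans (-≤⇒≤+ (ℚₚ.≤-trans (p≤∣p∣ _) (settled i N N≤i ≤-refl)))
      (ℚₚ.≤-trans (ℚₚ.+-monoʳ-≤ (grid (+ 1)) (≤-grid-floor q))
        (ℚₚ.≤-reflexive (trans (sym (grid-+ (+ 1) (+ 1 ℤ.+ ⌊ q ⌋₈)))
          (cong grid (sym (ℤₚ.+-assoc (+ 1) (+ 1) ⌊ q ⌋₈))))))
  where
  q = seq x N

-- Terms approximated by `z` lie between (z - 1)/8 and (z + 2)/8, an interval of length 3/8.
same⇒-≤ : ∀ z {p q} → p ℚ.≤ grid (+ 2 ℤ.+ z) → grid z ℚ.≤ grid (+ 1) ℚ.+ q → p ℚ.- q ℚ.≤ grid (+ 3)
same⇒-≤ z {p} {q} p≤ ≤q = ≤+⇒-≤ (begin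
  p                                        ≤⟨ p≤ ⟩
  grid (+ 2 ℤ.+ z)                         ≡⟨ grid-+ (+ 2) z ⟩
  grid (+ 2) ℚ.+ grid z                    ≤⟨ ℚₚ.+-monoʳ-≤ (grid (+ 2)) ≤q ⟩
  grid (+ 2) ℚ.+ (grid (+ 1) ℚ.+ q)        ≡⟨ ℚₚ.+-assoc (grid (+ 2)) (grid (+ 1)) q ⟨
  grid (+ 3) ℚ.+ q                         ∎)
  where open ℚₚ.≤-Reasoning

-- In units of 1/8, 19 = 1 + 16 + 2: the slack below, a difference of at most 2, and the slack
-- above.
close⇒≤ : ∀ z z′ {p q} → grid z ℚ.≤ grid (+ 1) ℚ.+ p → p ℚ.- q ℚ.≤ grid (+ 16) → q ℚ.≤ grid (+ 2 ℤ.+ z′) →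
  z ℤ.≤ + 19 ℤ.+ z′
close⇒≤ z z′ {p} {q} ≤p p-q≤ q≤ = grid-cancel-≤ (begin
  grid z                                           ≤⟨ ≤p ⟩
  grid (+ 1) ℚ.+ p                                 ≤⟨ ℚₚ.+-monoʳ-≤ (grid (+ 1)) (-≤⇒≤+ {p} {q} p-q≤) ⟩
  grid (+ 1) ℚ.+ (grid (+ 16) ℚ.+ q)               ≤⟨ ℚₚ.+-monoʳ-≤ (grid (+ 1)) (ℚₚ.+-monoʳ-≤ (grid (+ 16)) q≤) ⟩
  grid (+ 1) ℚ.+ (grid (+ 16) ℚ.+ grid (+ 2 ℤ.+ z′)) ≡⟨ cong (grid (+ 1) ℚ.+_) (sym (grid-+ (+ 16) (+ 2 ℤ.+ z′))) ⟩
  grid (+ 1) ℚ.+ grid (+ 16 ℤ.+ (+ 2 ℤ.+ z′))      ≡⟨ sym (grid-+ (+ 1) (+ 16 ℤ.+ (+ 2 ℤ.+ z′))) ⟩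
  grid (+ 1 ℤ.+ (+ 16 ℤ.+ (+ 2 ℤ.+ z′)))
    ≡⟨ cong grid (solve 1 (λ z → con (+ 1) :+ (con (+ 16) :+ (con (+ 2) :+ z)) := con (+ 19) :+ z) refl z′) ⟩
  grid (+ 19 ℤ.+ z′)                               ∎)
  where
  open ℚₚ.≤-Reasoning
  open ℤS.+-*-Solver

neg-difference : ∀ p q → ℚ.- (p ℚ.- q) ≡ q ℚ.- p
neg-difference = solve 2 (λ p q → :- (p :+ :- q) := q :+ :- p) refl
  where open ℚS.+-*-Solver

close-in-plane : ∀ {x x′ y y′ z w} → Approximates z x → Approximates z x′ →
  Approximates w y → Approximates w y′ → distance² (x , y) (x′ , y′) ≤ᴿ 1ℝ
close-in-plane {x} {x′} {y} {y′} {z} {w}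
  (from N₁ bounded ax) (from N₂ bounded ax′) (from N₃ bounded ay) (from N₄ bounded ay′) δ 0<δ =
  (N₁ ⊔ N₂) ⊔ (N₃ ⊔ N₄) , λ i N≤i →
    let p = ax  i (m⊔n≤o⇒m≤o N₁ N₂ (m⊔n≤o⇒m≤o (N₁ ⊔ N₂) (N₃ ⊔ N₄) N≤i))
        q = ax′ i (m⊔n≤o⇒n≤o N₁ N₂ (m⊔n≤o⇒m≤o (N₁ ⊔ N₂) (N₃ ⊔ N₄) N≤i))
        r = ay  i (m⊔n≤o⇒m≤o N₃ N₄ (m⊔n≤o⇒n≤o (N₁ ⊔ N₂) (N₃ ⊔ N₄) N≤i))
        s = ay′ i (m⊔n≤o⇒n≤o N₃ N₄ (m⊔n≤o⇒n≤o (N₁ ⊔ N₂) (N₃ ⊔ N₄) N≤i))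
    in ℚₚ.≤-trans
      (ℚₚ.+-mono-≤ (square (seq x i) (seq x′ i) z p q) (square (seq y i) (seq y′ i) w r s))
      (subst (ℚ._≤ 1ℚ ℚ.+ δ) (ℚₚ.+-identityʳ 1ℚ) (ℚₚ.+-monoʳ-≤ 1ℚ (ℚₚ.<⇒≤ 0<δ)))
  where
  square : ∀ p q z → grid z ℚ.≤ grid (+ 1) ℚ.+ p × p ℚ.≤ grid (+ 2 ℤ.+ z) →
           grid z ℚ.≤ grid (+ 1) ℚ.+ q × q ℚ.≤ grid (+ 2 ℤ.+ z) → (p ℚ.- q) ℚ.* (p ℚ.- q) ℚ.≤ grid (+ 4)
  square p q z (p≥ , p≤) (q≥ , q≤) = small-square (p ℚ.- q) (same⇒-≤ z p≤ q≥)
    (subst (ℚ._≤ grid (+ 3)) (sym (neg-difference p q)) (same⇒-≤ z q≤ p≥))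

approximations-close : ∀ {x x′ y y′ z z′ w w′} → Approximates z x → Approximates z′ x′ →
  Approximates w y → Approximates w′ y′ → distance² (x , y) (x′ , y′) ≤ᴿ 1ℝ →
  z ℤ.≤ + 19 ℤ.+ z′ × w ℤ.≤ + 19 ℤ.+ w′
approximations-close {x} {x′} {y} {y′} {z} {z′} {w} {w′}
  (from N₁ bounded ax) (from N₂ bounded ax′) (from N₃ bounded ay) (from N₄ bounded ay′) near =
  close⇒≤ z z′ {seq x i} (proj₁ p) (bounded-square X r (≤-+ʳ (X ℚ.* X) (Y ℚ.* Y) (0≤p² Y)) r≤2) (proj₂ q) ,
  close⇒≤ w w′ {seq y i} (proj₁ s) (bounded-square Y r (≤-+ˡ (X ℚ.* X) (Y ℚ.* Y) (0≤p² X)) r≤2) (proj₂ t)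
  where
  -- Slack 1 bounds the rational squared distance by 2 from `N₅` on. The conclusion concerns
  -- integers, so a single index beyond all thresholds suffices.
  N₅ = proj₁ (near 1ℚ (from-yes (0ℚ ℚ.<? 1ℚ)))
  i = ((N₁ ⊔ N₂) ⊔ (N₃ ⊔ N₄)) ⊔ N₅
  N₁₂≤i : (N₁ ⊔ N₂) ⊔ (N₃ ⊔ N₄) ≤ i
  N₁₂≤i = m≤m⊔n _ N₅
  p = ax  i (m⊔n≤o⇒m≤o N₁ N₂ (m⊔n≤o⇒m≤o (N₁ ⊔ N₂) (N₃ ⊔ N₄) N₁₂≤i))
  q = ax′ i (m⊔n≤o⇒n≤o N₁ N₂ (m⊔n≤o⇒m≤o (N₁ ⊔ N₂) (N₃ ⊔ N₄) N₁₂≤i))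
  s = ay  i (m⊔n≤o⇒m≤o N₃ N₄ (m⊔n≤o⇒n≤o (N₁ ⊔ N₂) (N₃ ⊔ N₄) N₁₂≤i))
  t = ay′ i (m⊔n≤o⇒n≤o N₃ N₄ (m⊔n≤o⇒n≤o (N₁ ⊔ N₂) (N₃ ⊔ N₄) N₁₂≤i))
  X = seq x i ℚ.- seq x′ i
  Y = seq y i ℚ.- seq y′ i
  r = X ℚ.* X ℚ.+ Y ℚ.* Y
  r≤2 : r ℚ.≤ grid (+ 16)
  r≤2 = proj₂ (near 1ℚ (from-yes (0ℚ ℚ.<? 1ℚ))) i (m≤n⊔m _ N₅)
  ≤-+ʳ : ∀ a b → 0ℚ ℚ.≤ b → a ℚ.≤ a ℚ.+ b
  ≤-+ʳ a b 0≤b = subst (ℚ._≤ a ℚ.+ b) (ℚₚ.+-identityʳ a) (ℚₚ.+-monoʳ-≤ a 0≤b)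
  ≤-+ˡ : ∀ a b → 0ℚ ℚ.≤ a → b ℚ.≤ a ℚ.+ b
  ≤-+ˡ a b 0≤a = subst (ℚ._≤ a ℚ.+ b) (ℚₚ.+-identityˡ b) (ℚₚ.+-monoˡ-≤ b 0≤a)

-- Covering by cliques

WithinZ : ℕ → ℤ → ℤ → Set
WithinZ L z z′ = z ℤ.≤ + L ℤ.+ z′ × z′ ℤ.≤ + L ℤ.+ z

WithinZ-refl : ∀ L z → WithinZ L z z
WithinZ-refl L z = ℤₚ.i≤j+i z (+ L) , ℤₚ.i≤j+i z (+ L)

WithinZ-trans : ∀ L L′ {x y z} → WithinZ L x y → WithinZ L′ y z → WithinZ (L + L′) x z
WithinZ-trans L L′ {x} {y} {z} (x≤y , y≤x) (y≤z , z≤y) =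
  ℤₚ.≤-trans x≤y (ℤₚ.≤-trans (ℤₚ.+-monoʳ-≤ (+ L) y≤z) (ℤₚ.≤-reflexive (sym (ℤₚ.+-assoc (+ L) (+ L′) z)))) ,
  ℤₚ.≤-trans z≤y (ℤₚ.≤-trans (ℤₚ.+-monoʳ-≤ (+ L′) y≤x) (ℤₚ.≤-reflexive
    (trans (sym (ℤₚ.+-assoc (+ L′) (+ L) x)) (cong (ℤ._+ x) (ℤₚ.+-comm (+ L′) (+ L))))))

window : ℕ → ℕ
window L = suc (L + L)

offset : ∀ L (z : ℤ) → Fin (window L) → ℤ
offset L z i = (+ toℕ i ℤ.+ z) ℤ.- + L

offset-surjective : ∀ L {z z′} → WithinZ L z z′ → ∃[ i ] offset L z i ≡ z′
offset-surjective L {z} {z′} (z≤ , z′≤) = fromℕ< t<  , (begin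
  (+ toℕ (fromℕ< t<) ℤ.+ z) ℤ.- + L   ≡⟨ cong (λ m → (+ m ℤ.+ z) ℤ.- + L) (toℕ-fromℕ< t<) ⟩
  (+ ℤ.∣ t ∣ ℤ.+ z) ℤ.- + L             ≡⟨ cong (λ m → (m ℤ.+ z) ℤ.- + L) (ℤₚ.0≤i⇒+∣i∣≡i 0≤t) ⟩
  (t ℤ.+ z) ℤ.- + L                   ≡⟨ solve 3 (λ z z′ L → (((L :+ z′) :- z) :+ z) :- L := z′) refl z z′ (+ L) ⟩
  z′                                  ∎)
  where
  open ≡-Reasoning
  open ℤS.+-*-Solver
  t : ℤ
  t = (+ L ℤ.+ z′) ℤ.- z
  0≤t : + 0 ℤ.≤ t
  0≤t = ℤₚ.i≤j⇒0≤j-i z≤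
  t≤ : t ℤ.≤ + (L + L)
  t≤ = subst (t ℤ.≤_) (solve 2 (λ L z → (L :+ (L :+ z)) :- z := L :+ L) refl (+ L) z)
         (ℤₚ.+-monoˡ-≤ (ℤ.- z) (ℤₚ.+-monoʳ-≤ (+ L) z′≤))
  t< : ℤ.∣ t ∣ < window L
  t< = s≤s (ℤₚ.drop‿+≤+ (subst (ℤ._≤ + (L + L)) (sym (ℤₚ.0≤i⇒+∣i∣≡i 0≤t)) t≤))

does-true⁺ : ∀ {P : Set} (P? : Dec P) → P → does P? ≡ true
does-true⁺ (yes _) p = refl
does-true⁺ (no ¬p) p = contradiction p ¬p

does-true⁻ : ∀ {P : Set} (P? : Dec P) → does P? ≡ true → P
does-true⁻ (yes p) _ = p

-- For each `a`, a family of `W` cliques that together contain every `b` related to `a`. This is the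
-- form in which geometry enters the size analysis.
Cover : ∀ {n} → ℕ → (Fin n → Fin n → Set) → Graph n → Set
Cover {n} W R G = Σ[ Q ∈ (Fin n → Fin W → Subset n) ]
  (∀ a c → Complete G (Q a c)) × (∀ {a b} → R a b → ∃[ c ] b ∈ Q a c)

module Cells {n} (G : Graph n) (disk : UnitDisk G) (cellX cellY : Fin n → ℤ)
  (approxX : ∀ v → Approximates (cellX v) (proj₁ (proj₁ disk v)))
  (approxY : ∀ v → Approximates (cellY v) (proj₂ (proj₁ disk v))) where

  Nearby : ℕ → Fin n → Fin n → Set
  Nearby L u v = WithinZ L (cellX u) (cellX v) × WithinZ L (cellY u) (cellY v)

  Nearby-trans : ∀ {L L′ u v w} → Nearby L u v → Nearby L′ v w → Nearby (L + L′) u w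
  Nearby-trans {L} {L′} (a , b) (c , d) = WithinZ-trans L L′ a c , WithinZ-trans L L′ b d

  ≡⇒Nearby : ∀ {u v} → u ≡ v → Nearby 19 u v
  ≡⇒Nearby {u} refl = WithinZ-refl 19 (cellX u) , WithinZ-refl 19 (cellY u)

  Adj⇒Nearby : ∀ {u v} → Adj G u v → Nearby 19 u v
  Adj⇒Nearby {u} {v} uv =
    let x≤ , y≤ = bound uv
        x≥ , y≥ = bound (trans (symm G v u) uv)
    in (x≤ , x≥) , (y≤ , y≥)
    where
    bound : ∀ {u v} → Adj G u v → cellX u ℤ.≤ + 19 ℤ.+ cellX v × cellY u ℤ.≤ + 19 ℤ.+ cellY v
    bound {u} {v} uv = approximations-close (approxX u) (approxX v) (approxY u) (approxY v)
      (Equivalence.to (proj₂ disk u v λ { refl → contradiction (trans (sym uv) (irrefl G u)) λ () }) uv)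

  sameCell⇒Adj : ∀ {u v} → cellX u ≡ cellX v → cellY u ≡ cellY v → u ≢ v → Adj G u v
  sameCell⇒Adj {u} {v} xx yy u≢v = Equivalence.from (proj₂ disk u v u≢v)
    (close-in-plane (approxX u) (subst (λ z → Approximates z (proj₁ (proj₁ disk v))) (sym xx) (approxX v))
                    (approxY u) (subst (λ z → Approximates z (proj₂ (proj₁ disk v))) (sym yy) (approxY v)))

  -- The cliques are the grid cells in a square window centred at the cell of `a`; nodes sharing a
  -- cell are at distance at most 1.
  cover : ∀ L → Cover (window L * window L) (Nearby L) G
  cover L = Q , clique , covers
    where
    InCell : Fin n → Fin (window L) × Fin (window L) → Fin n → Set
    InCell a (i , j) b = cellX b ≡ offset L (cellX a) i × cellY b ≡ offset L (cellY a) j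
    inCell? : ∀ a ij b → Dec (InCell a ij b)
    inCell? a (i , j) b = (cellX b ℤ.≟ offset L (cellX a) i) ×-dec (cellY b ℤ.≟ offset L (cellY a) j)
    Q : Fin n → Fin (window L * window L) → Subset n
    Q a c = tabulate λ b → does (inCell? a (remQuot (window L) c) b)
    ∈Q⇒InCell : ∀ {a c b} → b ∈ Q a c → InCell a (remQuot (window L) c) b
    ∈Q⇒InCell {a} {c} {b} b∈ = does-true⁻ (inCell? a (remQuot (window L) c) b)
      (trans (sym (lookup∘tabulate _ b)) ([]=⇒lookup b∈))
    InCell⇒∈Q : ∀ {a c b} → InCell a (remQuot (window L) c) b → b ∈ Q a c
    InCell⇒∈Q {a} {c} {b} p = lookup⇒[]= b _
      (trans (lookup∘tabulate _ b) (does-true⁺ (inCell? a (remQuot (window L) c) b) p))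
    clique : ∀ a c → Complete G (Q a c)
    clique a c u v u∈ v∈ u≢v =
      let ux , uy = ∈Q⇒InCell {a} {c} u∈
          vx , vy = ∈Q⇒InCell {a} {c} v∈
      in sameCell⇒Adj (trans ux (sym vx)) (trans uy (sym vy)) u≢v
    covers : ∀ {a b} → Nearby L a b → ∃[ c ] b ∈ Q a c
    covers {a} {b} (wx , wy) =
      let i , x≡ = offset-surjective L wx
          j , y≡ = offset-surjective L wy
      in combine i j , InCell⇒∈Q {a} {combine i j}
           (subst (λ ij → InCell a ij b) (sym (remQuot-combine i j)) (sym x≡ , sym y≡))

-- Connectivity and the approximation ratio

∉-─ : ∀ {n} (p q : Subset n) {v} → v ∈ p ─ q → v ∉ q
∉-─ (x ∷ p) (outside ∷ q) (there v∈) (there v∈q) = ∉-─ p q v∈ v∈q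
∉-─ (x ∷ p) (inside  ∷ q) (there v∈) (there v∈q) = ∉-─ p q v∈ v∈q

∣∣-subadditive : ∀ {n} (P A B : Subset n) → (∀ {v} → v ∈ P → v ∈ A ⊎ v ∈ B) → ∣ P ∣ ≤ ∣ A ∣ + ∣ B ∣
∣∣-subadditive P A B split = begin
  ∣ P ∣                                                ≡⟨ ∣S∣≡sum P ⟩
  sum (λ v → 𝟙 (lookup P v))                           ≤⟨ sum-mono-≤ (λ v → 𝟙-≤ {S = P} (bound v ∘ split)) ⟩
  sum (λ v → 𝟙 (lookup A v) + 𝟙 (lookup B v))          ≡⟨ ∑-distrib-+ (λ v → 𝟙 (lookup A v)) (λ v → 𝟙 (lookup B v)) ⟩
  sum (λ v → 𝟙 (lookup A v)) + sum (λ v → 𝟙 (lookup B v)) ≡⟨ cong₂ _+_ (∣S∣≡sum A) (∣S∣≡sum B) ⟨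
  ∣ A ∣ + ∣ B ∣                                        ∎
  where
  open ≤-Reasoning
  bound : ∀ v → v ∈ A ⊎ v ∈ B → 1 ≤ 𝟙 (lookup A v) + 𝟙 (lookup B v)
  bound v (inj₁ v∈A) = ≤-trans (≤-reflexive (sym (∈⇒𝟙≡1 {S = A} v∈A))) (m≤m+n _ _)
  bound v (inj₂ v∈B) = ≤-trans (≤-reflexive (sym (∈⇒𝟙≡1 {S = B} v∈B))) (m≤n+m _ _)

module _ {n} (G : Graph n) where

  Outside : Subset n → Fin n → Fin n → Set
  Outside X u v = u ∉ X × v ∉ X × Adj G u v

  Inside : Subset n → Subset n → Fin n → Fin n → Set
  Inside S X u v = (u ∈ S × u ∉ X) × (v ∈ S × v ∉ X) × Adj G u v

  -- The definition removes subsets of `S`, hence the passage to `X ∩ S`. In the complete case two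
  -- distinct remaining nodes are joined by an edge.
  KConnected⇒path : ∀ {k S} → KConnected G k S → ∀ X → ∣ X ∣ < k →
    ∀ {u v} → u ∈ S → u ∉ X → v ∈ S → v ∉ X → Star (Outside X) u v
  KConnected⇒path {S = S} (inj₁ conn) X small u∈S u∉X v∈S v∉X =
    gmap id (λ (a∈ , b∈ , ab) → out a∈ , out b∈ , ab)
      (conn (X ∩ S) (p∩q⊆q X S) (≤-<-trans (∣p∩q∣≤∣p∣ X S) small) _ _ (rest u∈S u∉X) (rest v∈S v∉X))
    where
    rest : ∀ {w} → w ∈ S → w ∉ X → w ∈ S ─ (X ∩ S)
    rest w∈S w∉X = x∈p∧x∉q⇒x∈p─q w∈S (w∉X ∘ proj₁ ∘ x∈p∩q⁻ X S)
    out : ∀ {w} → w ∈ S ─ (X ∩ S) → w ∉ X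
    out w∈ w∈X = ∉-─ S (X ∩ S) w∈ (x∈p∩q⁺ (w∈X , p─q⊆p S (X ∩ S) w∈))
  KConnected⇒path (inj₂ (complete , _)) X small {u} {v} u∈S u∉X v∈S v∉X with u ≟ v
  ... | yes refl = ε
  ... | no  u≢v  = (u∉X , v∉X , complete u v u∈S v∈S u≢v) ◅ ε

  -- A node outside `S` has at least m ≥ k > |X| neighbours in `S`, so one of them avoids `X`. Both
  -- ends are thus connected to `S`, and a path there completes the connection.
  CDS⇒path : ∀ {k m S} → k ≤ m → IsCDS G k m S → ∀ X → ∣ X ∣ < k →
    ∀ {u v} → u ∉ X → v ∉ X → Star (Outside X) u v
  CDS⇒path {S = S} k≤m (conn , dom) X small {u} {v} u∉X v∉X =
    let s , s∈S , s∉X , us = anchor u u∉X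
        t , t∈S , t∉X , vt = anchor v v∉X
    in us ◅◅ KConnected⇒path conn X small s∈S s∉X t∈S t∉X ◅◅
       reverse (λ (a , b , ab) → b , a , Adj-sym G ab) vt
    where
    anchor : ∀ w → w ∉ X → ∃[ s ] s ∈ S × s ∉ X × Star (Outside X) w s
    anchor w w∉X with w ∈? S
    ... | yes w∈S = w , w∈S , w∉X , ε
    ... | no  w∉S =
      let s , s∈ , s∉X = ∃∈∖ X (neighbours G w ∩ S) (<-≤-trans small (≤-trans k≤m (dom w w∉S)))
          s∈N , s∈S = x∈p∩q⁻ (neighbours G w) S s∈
      in s , s∈S , s∉X , (w∉X , s∉X , ∈-neighbours⁻ G s∈N) ◅ ε

  module _ (k m : ℕ) where

    open Semantics G k m using (_~_; Adj⇒~; ~-refl; ~-sym; ~⇒≡⊎Adj; Linked; Reach)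

    -- A path of G - X is shadowed by anchors: each of its nodes has an equal or adjacent node of
    -- `D` outside `X`. For an edge u v with anchors t and t′, the walk t ~ u ~ v ~ t′ avoids `X`,
    -- and linking replaces it by one inside `S`.
    linked⇒KConnected : ∀ {D S} → D ⊆ S → MDominating G k D →
      (∀ {a b} → a ∈ D → b ∈ D → Linked a b S) →
      (∀ X → ∣ X ∣ < k → ∀ {u v} → u ∉ X → v ∉ X → Star (Outside X) u v) →
      KConnected G k S
    linked⇒KConnected {D} {S} D⊆S dom linked path = inj₁ λ X _ small u v u∈ v∈ →
      gmap id (λ ((a∈S , a∉X) , (b∈S , b∉X) , ab) →
          x∈p∧x∉q⇒x∈p─q a∈S a∉X , x∈p∧x∉q⇒x∈p─q b∈S b∉X , ab)
        (connect X small (p─q⊆p S X u∈) (∉-─ S X u∈) (p─q⊆p S X v∈) (∉-─ S X v∈))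
      where
      module _ (X : Subset n) (small : ∣ X ∣ < k) where
        edge-path : ∀ {u v} → u ∈ S → u ∉ X → v ∈ S → v ∉ X → u ~ v → Star (Inside S X) u v
        edge-path u∈S u∉X v∈S v∉X uv with ~⇒≡⊎Adj uv
        ... | inj₁ refl = ε
        ... | inj₂ adj′ = ((u∈S , u∉X) , (v∈S , v∉X) , adj′) ◅ ε

        Anchor : Fin n → Fin n → Set
        Anchor u t = t ∈ D × t ∉ X × t ~ u

        anchor : ∀ u → u ∉ X → ∃[ t ] Anchor u t
        anchor u u∉X with u ∈? D
        ... | yes u∈D = u , u∈D , u∉X , ~-refl
        ... | no  u∉D =
          let t , t∈ , t∉X = ∃∈∖ X (neighbours G u ∩ D) (<-≤-trans small (dom u u∉D))
              t∈N , t∈D = x∈p∩q⁻ (neighbours G u) D t∈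
          in t , t∈D , t∉X , ~-sym (Adj⇒~ (∈-neighbours⁻ G t∈N))

        hop : ∀ {u v t t′} → Outside X u v → Anchor u t → Anchor v t′ → Star (Inside S X) t t′
        hop (u∉X , v∉X , uv) (t∈D , t∉X , tu) (t′∈D , t′∉X , t′v) =
          let w , w′ , (w∈S , w′∈S) , (w∉X , w′∉X) , tw , ww′ , w′t′ =
                linked t∈D t′∈D X small u∉X v∉X tu (Adj⇒~ uv) (~-sym t′v)
          in edge-path (D⊆S t∈D) t∉X w∈S w∉X tw ◅◅
             edge-path w∈S w∉X w′∈S w′∉X ww′ ◅◅
             edge-path w′∈S w′∉X (D⊆S t′∈D) t′∉X w′t′

        follow : ∀ {u v t} → Star (Outside X) u v → Anchor u t → ∃[ t′ ] Anchor v t′ × Star (Inside S X) t t′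
        follow ε A = _ , A , ε
        follow (step@(_ , w∉X , _) ◅ rest) A =
          let t , B = anchor _ w∉X
              t′ , C , p = follow rest B
          in t′ , C , hop step A B ◅◅ p

        connect : ∀ {u v} → u ∈ S → u ∉ X → v ∈ S → v ∉ X → Star (Inside S X) u v
        connect {u} {v} u∈S u∉X v∈S v∉X =
          let t , A@(t∈D , t∉X , tu) = anchor u u∉X
              t′ , (t′∈D , t′∉X , t′v) , p = follow (path X small u∉X v∉X) A
          in edge-path u∈S u∉X (D⊆S t∈D) t∉X (~-sym tu) ◅◅ p ◅◅ edge-path (D⊆S t′∈D) t′∉X v∈S v∉X t′v

    module _ (disk : UnitDisk G) where

      private
        module C = Cells G disk
          (λ v → proj₁ (approximate (proj₁ (proj₁ disk v)))) (λ v → proj₁ (approximate (proj₂ (proj₁ disk v))))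
          (λ v → proj₂ (approximate (proj₁ (proj₁ disk v)))) (λ v → proj₂ (approximate (proj₂ (proj₁ disk v))))

        ~⇒Nearby : ∀ {u v} → u ~ v → C.Nearby 19 u v
        ~⇒Nearby uv with ~⇒≡⊎Adj uv
        ... | inj₁ eq   = C.≡⇒Nearby eq
        ... | inj₂ adj′ = C.Adj⇒Nearby adj′

      -- Each `~`-step moves at most 19 grid units in either coordinate, and 57 is three times 19.
      reach-cover : Cover (window 57 * window 57) Reach G
      reach-cover = let Q , clique , covers = C.cover 57 in Q , clique ,
        λ (w , w′ , aw , ww′ , w′b) →
          covers (C.Nearby-trans (C.Nearby-trans (~⇒Nearby aw) (~⇒Nearby ww′)) (~⇒Nearby w′b))

-- The bounds are proved jointly, since expanding the square of k + 1 calls for the linear one.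
k≤5^k×k²≤5^k : ∀ k → k ≤ 5 ^ k × k * k ≤ 5 ^ k
k≤5^k×k²≤5^k zero    = z≤n , z≤n
k≤5^k×k²≤5^k (suc k) = let k≤p , k²≤p = k≤5^k×k²≤5^k k in
    (begin
      1 + k              ≤⟨ +-mono-≤ (m^n>0 5 k) k≤p ⟩
      p + p              ≤⟨ m≤m+n (p + p) (3 * p) ⟩
      (p + p) + 3 * p    ≡⟨ solve 1 (λ p → (p :+ p) :+ con 3 :* p := con 5 :* p) refl p ⟩
      5 * p              ∎)
  , (begin
      suc k * suc k
        ≡⟨ solve 1 (λ k → (con 1 :+ k) :* (con 1 :+ k) := (con 1 :+ k) :+ (k :+ k :* k)) refl k ⟩
      (1 + k) + (k + k * k)        ≤⟨ +-mono-≤ (+-mono-≤ (m^n>0 5 k) k≤p) (+-mono-≤ k≤p k²≤p) ⟩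
      (p + p) + (p + p)            ≤⟨ m≤m+n ((p + p) + (p + p)) p ⟩
      ((p + p) + (p + p)) + p      ≡⟨ solve 1 (λ p → ((p :+ p) :+ (p :+ p)) :+ p := con 5 :* p) refl p ⟩
      5 * p                        ∎)
  where
  open ≤-Reasoning
  open +-*-Solver
  p = 5 ^ k

-- Correctness and size of the output

module Analysis {n} (G : Graph n) (k m : ℕ) (1≤k : 1 ≤ k) (k≤m : k ≤ m) where

  open Semantics G k m

  s₀ : Store n
  s₀ = store (λ _ → ∅) 0

  module G₁ = Grow kₚ s₀
  module L  = LinkAll G₁.s₁
  module G₂ = Grow mₚ L.s₁
  module I₁ = G₁.Inv (proj₁ G₁.grown)
  module IL = L.Inv (proj₁ L.all-linked)
  module I₂ = G₂.Inv (proj₁ G₂.grown)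

  D₁ D₂ S : Subset n
  D₁ = sets G₁.s₁ domₐ
  D₂ = sets G₂.s₁ domₐ
  S  = sets G₂.s₁ outₐ

  D₁⊆out : D₁ ⊆ sets G₁.s₁ outₐ
  D₁⊆out = I₁.shadow id

  D₂⊆S : D₂ ⊆ S
  D₂⊆S = I₂.shadow (IL.out-⊆ ∘ D₁⊆out ∘ subst (_ ∈_) IL.dom-≡)

  -- The given (k,m)-CDS makes G - X connected for every `X` of fewer than `k` nodes; anchors in
  -- `D₁` and the links transfer this to `S`. Domination is inherited from `D₂`.
  isCDS : (∃[ S₀ ] IsCDS G k m S₀) → IsCDS G k m S
  isCDS (_ , cds) =
    linked⇒KConnected G k m (I₂.out-⊆ ∘ IL.out-⊆ ∘ D₁⊆out) G₁.dominating
      (λ a∈ b∈ → Linked-mono I₂.out-⊆ (proj₂ L.all-linked _ _ a∈ b∈))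
      (CDS⇒path G k≤m cds) ,
    λ v v∉S → ≤-trans (G₂.dominating v (v∉S ∘ D₂⊆S)) (p⊆q⇒∣p∣≤∣q∣ λ x∈ →
      let x∈N , x∈D = x∈p∩q⁻ (neighbours G v) D₂ x∈ in x∈p∩q⁺ (x∈N , D₂⊆S x∈D))

  module _ {W} (Q-cover : Cover W Reach G) where

    private
      Q      = proj₁ Q-cover
      clique = proj₁ (proj₂ Q-cover)
      covers : ∀ {a b} → Reach a b → ∃[ c ] b ∈ Q a c
      covers = proj₂ (proj₂ Q-cover)

    D₁-sparse : ∀ Q → Complete G Q → ∣ Q ∩ D₁ ∣ ≤ k
    D₁-sparse Q c = I₁.sparse Q c
      (≤-trans (p⊆q⇒∣p∣≤∣q∣ (λ x∈ → proj₂ (x∈p∩q⁻ Q ∅ x∈))) (≤-trans (≤-reflexive (∣⊥∣≡0 n)) z≤n))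

    D₂-sparse : ∀ Q → Complete G Q → ∣ Q ∩ D₂ ∣ ≤ m
    D₂-sparse Q c = I₂.sparse Q c
      (≤-trans (subst (λ D → ∣ Q ∩ D ∣ ≤ k) (sym IL.dom-≡) (D₁-sparse Q c)) k≤m)

    region-sparse : ∀ (D R : Subset n) t a → (∀ {b} → b ∈ R → ∃[ c ] b ∈ Q a c) →
      (∀ Q → Complete G Q → ∣ Q ∩ D ∣ ≤ t) → ∣ R ∩ D ∣ ≤ W * t
    region-sparse D R t a R⊆ sparse = union-bound (R ∩ D) (Q a) t
      (R⊆ ∘ proj₁ ∘ x∈p∩q⁻ R D)
      (λ c → ≤-trans (p⊆q⇒∣p∣≤∣q∣ λ x∈ →
          let x∈Q , x∈RD = x∈p∩q⁻ (Q a c) (R ∩ D) x∈ in x∈p∩q⁺ (x∈Q , proj₂ (x∈p∩q⁻ R D x∈RD)))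
        (sparse (Q a c) (clique a c)))

    neighbours-covered : ∀ {a b} → b ∈ neighbours G a → ∃[ c ] b ∈ Q a c
    neighbours-covered {a} {b} b∈ = covers (a , a , ~-refl , ~-refl , Adj⇒~ (∈-neighbours⁻ G b∈))

    -- The union of the cliques around `a`: a decidable superset of the nodes that `a` reaches.
    reached : Fin n → Subset n
    reached a = tabulate λ b → does (any? λ c → b ∈? Q a c)

    reached⁺ : ∀ a b → Reach a b → b ∈ reached a
    reached⁺ a b r = lookup⇒[]= b _ (trans (lookup∘tabulate _ b) (does-true⁺ (any? λ c → b ∈? Q a c) (covers r)))

    reached⁻ : ∀ {a b} → b ∈ reached a → ∃[ c ] b ∈ Q a c
    reached⁻ {a} {b} b∈ = does-true⁻ (any? λ c → b ∈? Q a c) (trans (sym (lookup∘tabulate _ b)) ([]=⇒lookup b∈))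

    -- The output consists of `D₁`, the linking nodes and `D₂`. Both dominating sets have at most (W
    -- + 1) OPT nodes, and each `a` in `D₁` has at most W k partners in `D₁` that cause any linking
    -- cost.
    size-bound : ∀ opt → IsOPT G k m opt → ∣ S ∣ ≤ (suc W * (2 + 6 * W)) * (k * 5 ^ k) * opt
    size-bound opt ((D , (_ , dom) , refl) , _) = begin
      ∣ S ∣
        ≤⟨ ∣∣-subadditive S (sets L.s₁ outₐ) D₂ I₂.within ⟩
      ∣ sets L.s₁ outₐ ∣ + ∣ D₂ ∣
        ≤⟨ +-monoˡ-≤ ∣ D₂ ∣ (L.out-growth reached (W * k) reached⁺
             (λ a → region-sparse D₁ (reached a) k a reached⁻ D₁-sparse)) ⟩
      ∣ sets G₁.s₁ outₐ ∣ + ∣ D₁ ∣ * (W * k * linkCost) + ∣ D₂ ∣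
        ≤⟨ +-monoˡ-≤ ∣ D₂ ∣ (+-monoˡ-≤ (∣ D₁ ∣ * (W * k * linkCost)) (p⊆q⇒∣p∣≤∣q∣ out⊆D₁)) ⟩
      ∣ D₁ ∣ + ∣ D₁ ∣ * (W * k * linkCost) + ∣ D₂ ∣
        ≤⟨ +-mono-≤ (+-mono-≤ D₁≤ (*-mono-≤ D₁≤ (*-monoʳ-≤ (W * k) linkCost≤))) D₂≤ ⟩
      B + B * (W * k * (6 * (k * k))) + B
        -- The linear terms are padded by the factor k 5^k, which is at least 1, and k² is raised to
        -- 5^k, so that all three terms share the factor k 5^k.
        ≤⟨ +-mono-≤ (+-mono-≤ B≤ (*-monoʳ-≤ B (*-monoʳ-≤ (W * k) (*-monoʳ-≤ 6 (proj₂ (k≤5^k×k²≤5^k k)))))) B≤ ⟩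
      B * (k * 5 ^ k) + B * (W * k * (6 * 5 ^ k)) + B * (k * 5 ^ k)
        ≡⟨ solve 5 (λ W o k p B → (B :* o) :* (k :* p) :+ (B :* o) :* (W :* k :* (con 6 :* p)) :+ (B :* o) :* (k :* p)
             := (B :* (con 2 :+ con 6 :* W)) :* (k :* p) :* o) refl W ∣ D ∣ k (5 ^ k) (suc W) ⟩
      (suc W * (2 + 6 * W)) * (k * 5 ^ k) * ∣ D ∣ ∎
      where
      open ≤-Reasoning
      open +-*-Solver
      B : ℕ
      B = suc W * ∣ D ∣
      D₁≤ : ∣ D₁ ∣ ≤ B
      D₁≤ = dominating-bound G D₁ D k W 1≤k (λ v v∉D → ≤-trans k≤m (dom v v∉D))
        (λ d → region-sparse D₁ (neighbours G d) k d neighbours-covered D₁-sparse)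
      D₂≤ : ∣ D₂ ∣ ≤ B
      D₂≤ = dominating-bound G D₂ D m W (≤-trans 1≤k k≤m) dom
        (λ d → region-sparse D₂ (neighbours G d) m d neighbours-covered D₂-sparse)
      out⊆D₁ : sets G₁.s₁ outₐ ⊆ D₁
      out⊆D₁ x∈ with I₁.within x∈
      ... | inj₁ x∈∅ = contradiction x∈∅ ∉⊥
      ... | inj₂ x∈D = x∈D
      B≤ : B ≤ B * (k * 5 ^ k)
      B≤ = ≤-trans (≤-reflexive (sym (*-identityʳ B))) (*-monoʳ-≤ B (*-mono-≤ 1≤k (m^n>0 5 k)))
      linkCost≤ : linkCost ≤ 6 * (k * k)
      linkCost≤ = begin
        (k + k) * (1 + (k + k))   ≤⟨ *-monoʳ-≤ (k + k) (+-monoˡ-≤ (k + k) 1≤k) ⟩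
        (k + k) * (k + (k + k))   ≡⟨ solve 1 (λ k → (k :+ k) :* (k :+ (k :+ k)) := con 6 :* (k :* k)) refl k ⟩
        6 * (k * k)               ∎

-- Guarantees for the machine program

module _ {n} (G : Graph n) (k m : ℕ) where

  open Correctness G k m

  input-⊨ : input G k m ⊨ store (λ _ → ∅) 0
  input-⊨ = record
    { size = refl ; params = λ { kₚ → refl ; mₚ → refl } ; counter = refl ; matrix = λ _ → refl
    ; arrays = λ { outₐ v → sym (lookup-replicate v false) ; domₐ v → sym (lookup-replicate v false)
                 ; markₐ v → sym (lookup-replicate v false) } }

  output-≡ : ∀ {σ s} → σ ⊨ s → output n σ ≡ sets s outₐ
  output-≡ {s = s} R = trans (tabulate-cong (_⊨_.arrays R outₐ)) (tabulate∘lookup (sets s outₐ))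

-- 115 squared: the number of grid cells at most 57 units away in both coordinates.
cells : ℕ
cells = window 57 * window 57

corollary1 : ∃[ C ] ∃[ A ] ∃[ c ] ∃[ d ]
    ∀ {n : ℕ} (G : Graph n) (k m : ℕ) → 1 ≤ k → k ≤ m →
    UnitDisk G → (∃[ S ] IsCDS G k m S) →
    ∃[ σ ] ∃[ t ]
    (A , input G k m ⇓ σ , t) ×
    t ≤ c * suc (inputSize n k m) ^ d ×
    IsCDS G k m (output n σ) ×
    (∀ opt → IsOPT G k m opt → ∣ output n σ ∣ ≤ C * (k * 5 ^ k) * opt)
-- The approximation constant is that of `size-bound` for `W = cells`; coefficient and degree of the
-- time bound depend only on the syntax of `algorithm`.
corollary1 = suc cells * (2 + 6 * cells) , compile algorithm , timeCoeff algorithm , timeDegree algorithm ,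
  λ {n} G k m 1≤k k≤m disk exists →
    let open Analysis G k m 1≤k k≤m
        open Correctness G k m
        σ , t , runs , R , _ , t≤ = compile-correct algorithm [] (input-⊨ G k m) (λ ())
        out≡S = output-≡ G k m R
    in σ , t , runs ,
       ≤-trans t≤ (≤-trans (time-polynomial n algorithm)
         (*-monoʳ-≤ (timeCoeff algorithm) (^-monoˡ-≤ (timeDegree algorithm) (s≤s (n≤inputSize n k m))))) ,
       subst (IsCDS G k m) (sym out≡S) (isCDS exists) ,
       λ opt isOPT → subst (λ X → ∣ X ∣ ≤ suc cells * (2 + 6 * cells) * (k * 5 ^ k) * opt) (sym out≡S)
         (size-bound (reach-cover G k m disk) opt isOPT)
  where
  n≤inputSize : ∀ n k m → n ≤ inputSize n k m
  n≤inputSize zero    k m = z≤n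
  n≤inputSize (suc n) k m = ≤-trans (m≤m*n (suc n) (suc n))
    (≤-trans (m≤m+n (suc n * suc n) ⌈log₂ suc k ⌉) (m≤m+n _ ⌈log₂ suc m ⌉))
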